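{- Fix an integer $r\geq 3$ and a real number $C$ with $1\le C<\frac{3}{2}$. There exists $n_0=n_0(r,C)$ such that for all $n\ge n_0$ the following holds. Let $\mathcal{F}\subseteq\binom{[n]}{r}$ be an intersecting family whose $C$-weighted diversity $d_C(\mathcal{F})$ is maximum among all intersecting families in $\binom{[n]}{r}$. Then, up to a permutation of the ground set $[n]$: (i) if $C=1$, then $\mathcal{A}_{\mathbb{K}}\subseteq\mathcal{F}\subseteq\mathcal{A}_{\mathbb{K}^+}$; (ii) if $1<C<\frac{3}{2}$, then $\mathcal{F}=\mathcal{A}_{\mathbb{K}}$. Moreover, for $1\le C<\frac32$, $d_C(\mathcal{F})\le (3-2C)\binom{n-3}{r-2}$.
   Context: $[n]=\{1,\dots,n\}$ and $\binom{[n]}{r}$ is the set of $r$-element subsets of $[n]$. A family $\mathcal{F}$ is intersecting if every two of its members have nonempty intersection. The maximum degree $\Delta(\mathcal{F})$ is the maximum, over vertices $x\in[n]$, of the number of members of $\mathcal{F}$ containing $x$. For a real $C$, the $C$-weighted diversity is $d_C(\mathcal{F}):=|\mathcal{F}|-C\cdot\Delta(\mathcal{F})$. Define $\mathcal{A}_{\mathbb{K}}:=\{E\in\binom{[n]}{r}: |E\cap\{1,2,3\}|=2\}$ and $\mathcal{A}_{\mathbb{K}^+}:=\{E\in\binom{[n]}{r}: |E\cap\{1,2,3\}|\ge 2\}$. -}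

module Defs where

open import Data.Bool using (Bool; true; false; if_then_else_)
open import Data.Nat as ℕ using (ℕ; zero; suc; _⊔_; _<ᵇ_)
open import Data.Integer using (+_)
open import Data.Rational using (ℚ; _/_; _≤_; _<_; _*_; _-_; 0ℚ)
open import Data.Product using (Σ; ∃; _×_; _,_)
open import Data.Sum using (_⊎_)
open import Data.Empty using (⊥)
open import Relation.Nullary using (¬_)
open import Relation.Binary.PropositionalEquality using (_≡_)
open import Data.List using (List; []; _∷_; map; _++_; length; filterᵇ; foldr)
open import Data.Vec using (Vec; []; _∷_; tabulate; lookup)
open import Data.Fin using (Fin; toℕ)
open import Data.Fin.Subset using (Subset; _∩_; Nonempty; ∣_∣)
open import Data.Fin.Permutation using (Permutation; _⟨$⟩ʳ_)
open import Data.List using () renaming (allFin to allFinL)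

-- Real numbers as (constructive, two-sided) Dedekind cuts on ℚ.
-- Lo q  means  q < C ;  Up q  means  C < q.

record ℝ : Set₁ where
  field
    Lo Up      : ℚ → Set
    lo-inh     : ∃ Lo
    up-inh     : ∃ Up
    lo-down    : ∀ p q → p < q → Lo q → Lo p
    up-up      : ∀ p q → p < q → Up p → Up q
    lo-round   : ∀ q → Lo q → ∃ λ q' → q < q' × Lo q'
    up-round   : ∀ q → Up q → ∃ λ q' → q' < q × Up q'
    disjoint   : ∀ q → ¬ (Lo q × Up q)
    located    : ∀ p q → p < q → Lo p ⊎ Up q

open ℝ public

-- "s ≤ C · t"  for rationals s, t and a real C.
-- (For t ≥ 0, C·t = inf { q·t : C < q }; for t ≤ 0, C·t = inf { q·t : q < C }.)
_≤_·_ : ℚ → ℝ → ℚ → Set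
s ≤ C · t = (∀ q → Up C q → 0ℚ ≤ t → s ≤ q * t)
          × (∀ q → Lo C q → t ≤ 0ℚ → s ≤ q * t)

⟦_⟧ : ℕ → ℚ
⟦ n ⟧ = + n / 1

allSubsets : (n : ℕ) → List (Subset n)
allSubsets zero    = [] ∷ []
allSubsets (suc n) = map (true ∷_) (allSubsets n) ++ map (false ∷_) (allSubsets n)

Family : ℕ → Set
Family n = Subset n → Bool

card : ∀ {n} → Family n → ℕ
card {n} F = length (filterᵇ F (allSubsets n))

deg : ∀ {n} → Family n → Fin n → ℕ
deg {n} F x = length (filterᵇ (λ E → if F E then lookup E x else false) (allSubsets n))

Δ : ∀ {n} → Family n → ℕ
Δ {n} F = foldr (λ x m → deg F x ⊔ m) 0 (allFinL n)

Uniform : ∀ {n} → ℕ → Family n → Set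
Uniform r F = ∀ E → F E ≡ true → ∣ E ∣ ≡ r

Intersecting : ∀ {n} → Family n → Set
Intersecting F = ∀ E E' → F E ≡ true → F E' ≡ true → Nonempty (E ∩ E')

-- d_C(G) ≤ d_C(F), i.e. |G| - C Δ(G) ≤ |F| - C Δ(F),
-- i.e. |G| - |F| ≤ C (Δ(G) - Δ(F)).
dC≤ : ∀ {n} → ℝ → Family n → Family n → Set
dC≤ C G F = (⟦ card G ⟧ - ⟦ card F ⟧) ≤ C · (⟦ Δ G ⟧ - ⟦ Δ F ⟧)

MaxDiv : ∀ {n} → ℕ → ℝ → Family n → Set
MaxDiv {n} r C F = Uniform r F × Intersecting F
  × (∀ (G : Family n) → Uniform r G → Intersecting G → dC≤ C G F)

-- |E ∩ {1,2,3}|, where {1,2,3} is the set of the first three elements of Fin n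
-- (0-indexed: toℕ i < 3)
inK : ∀ {n} → Subset n → ℕ
inK {n} E = length (filterᵇ (λ i → if toℕ i <ᵇ 3 then lookup E i else false) (allFinL n))

A𝕂 : ∀ {n} → ℕ → Subset n → Set
A𝕂 r E = ∣ E ∣ ≡ r × inK E ≡ 2

A𝕂⁺ : ∀ {n} → ℕ → Subset n → Set
A𝕂⁺ r E = ∣ E ∣ ≡ r × 2 ℕ.≤ inK E

_⟪_⟫ : ∀ {n} → Subset n → Permutation n n → Subset n
E ⟪ σ ⟫ = tabulate (λ i → lookup E (σ ⟨$⟩ʳ i))

1≤C : ℝ → Set
1≤C C = (+ 1 / 1) ≤ C · (+ 1 / 1)

C≤1 : ℝ → Set
C≤1 C = (Data.Rational.- (+ 1 / 1)) ≤ C · (Data.Rational.- (+ 1 / 1))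

C<3/2 : ℝ → Set
C<3/2 C = Up C (+ 3 / 2)

1<C : ℝ → Set
1<C C = Lo C (+ 1 / 1)

{-# OPTIONS --safe #-}
module Submission where

-- Call a pair of vertices heavy if more than r N₃ members contain it, N₃ = C(n-3, r-3) being the number of r-sets
-- through three given points.  A heavy pair meets every member, and two heavy pairs intersect, so the heavy pairs
-- form a star or a triangle; moreover at most r³ N₃ members contain no heavy pair.  For a star, |F| ≤ Δ(F) + r³ N₃,
-- which for large n is incompatible with being at least as good as the triangle family, of weighted diversity
-- (3 - 2C) N with N = C(n-3, r-2).  Hence every member has at least two points in some triangle.  If α members have
-- exactly two and τ have three, then |F| = α + τ, 2α + 3τ ≤ 3Δ(F) and α ≤ 3N, whence the bound; equality forces
-- α = 3N, and also τ = 0 unless C = 1.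

open import Defs

-- The real `C` is known only through its cuts, so optimality of F, an inequality s ≤ C · t, has to
-- be read through rational slopes: those above C when t = 2N - Δ(F) is nonnegative, those below C
-- when it is nonpositive. For Δ(F) ≤ 2N a single slope q = u / (1 + d) with C < q < 3/2 suffices.
-- For Δ(F) ≥ 2N slope 1 is wanted, although at C = 1 only rationals below 1 are available. Clearing
-- denominators then leaves inequalities between natural numbers. The denominator 1 + d is the only
-- way in which `C` enters n₀. In the star case d_C(F) ≤ r³ N₃ because C ≥ 1, while 3 - 2q ≥ 1 / (1
-- + d); hence N > (1 + d) r³ N₃ excludes it, and N / N₃ grows linearly in n. The factor r³ collects
-- two choices of a point in an r-set and the heaviness threshold r N₃.

-- Sums and counts over all subsets of the ground set

module Counting where

  open import Data.Bool using (Bool; true; false; not; _∧_; if_then_else_)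
  open import Data.Bool.Properties using (∧-assoc; ∧-comm)
  open import Data.Fin using (Fin; zero; suc)
  open import Data.Fin.Subset using (Subset; ∣_∣)
  open import Data.List using ([]; _∷_; _++_; map; length; filterᵇ; foldr; allFin)
  open import Data.List.Membership.Propositional using (_∈_)
  open import Data.List.Membership.Propositional.Properties using (∈-allFin)
  open import Data.List.Relation.Unary.Any using (here; there)
  open import Data.Maybe using (Maybe; just; nothing)
  open import Data.Nat
  open import Data.Nat.Combinatorics using (nCk+nC[k+1]≡[n+1]C[k+1]) renaming (_C_ to _choose_)
  open import Data.Nat.Properties
  open import Data.Nat.Tactic.RingSolver using (solve-∀)
  open import Data.Product using (∃; _×_; _,_)
  open import Data.Sum using (_⊎_; inj₁; inj₂)
  open import Data.Vec using (Vec; []; _∷_; lookup; replicate; _[_]≔_)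
  open import Data.Vec.Properties using (lookup-replicate; lookup∘update′)
  open import Function using (_∘_)
  open import Relation.Binary.PropositionalEquality

  private variable
    n m : ℕ

  -- Recursion on the first coordinate, in place of a sum over the list `allSubsets`, makes facts
  -- about totals plain inductions on n; `length-filter-allSubsets` links the two.
  total : (Subset n → ℕ) → ℕ
  total {zero}  f = f []
  total {suc n} f = total (f ∘ (true ∷_)) + total (f ∘ (false ∷_))

  ind : Bool → ℕ
  ind b = if b then 1 else 0

  count : (Subset n → Bool) → ℕ
  count P = total (ind ∘ P)

  private
    +-swap : ∀ a b c d → (a + b) + (c + d) ≡ (a + c) + (b + d)
    +-swap = solve-∀

  total-+ : (f g : Subset n → ℕ) → total (λ E → f E + g E) ≡ total f + total g
  total-+ {zero}  f g = refl
  total-+ {suc n} f g = trans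
    (cong₂ _+_ (total-+ (f ∘ (true ∷_)) (g ∘ (true ∷_))) (total-+ (f ∘ (false ∷_)) (g ∘ (false ∷_))))
    (+-swap (total (f ∘ (true ∷_))) (total (g ∘ (true ∷_))) _ _)

  total-mono : {f g : Subset n → ℕ} → (∀ E → f E ≤ g E) → total f ≤ total g
  total-mono {zero}  f≤g = f≤g []
  total-mono {suc n} f≤g = +-mono-≤ (total-mono (f≤g ∘ (true ∷_))) (total-mono (f≤g ∘ (false ∷_)))

  total-cong : {f g : Subset n → ℕ} → (∀ E → f E ≡ g E) → total f ≡ total g
  total-cong f≡g = ≤-antisym (total-mono (≤-reflexive ∘ f≡g)) (total-mono (≤-reflexive ∘ sym ∘ f≡g))

  total-zero : ∀ n → total {n} (λ _ → 0) ≡ 0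
  total-zero zero    = refl
  total-zero (suc n) = cong₂ _+_ (total-zero n) (total-zero n)

  -- A deficit of f on one half of the cube cannot be made up on the other half, where f is at most
  -- g as well. This turns equal counts into equal families, and a zero count into emptiness.
  total-squeeze : {f g : Subset n → ℕ} → (∀ E → f E ≤ g E) → total g ≤ total f → ∀ E → g E ≤ f E
  total-squeeze f≤g tg≤tf [] = tg≤tf
  total-squeeze {f = f} {g} f≤g tg≤tf (true ∷ E) =
    total-squeeze (f≤g ∘ (true ∷_)) (+-cancelʳ-≤ _ _ _ (≤-trans tg≤tf
      (+-monoʳ-≤ (total (f ∘ (true ∷_))) (total-mono (f≤g ∘ (false ∷_)))))) E
  total-squeeze {f = f} {g} f≤g tg≤tf (false ∷ E) =
    total-squeeze (f≤g ∘ (false ∷_)) (+-cancelˡ-≤ (total (g ∘ (true ∷_))) _ _ (≤-trans tg≤tf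
      (+-monoˡ-≤ _ (total-mono (f≤g ∘ (true ∷_)))))) E

  ind-mono : ∀ {b c} → (b ≡ true → c ≡ true) → ind b ≤ ind c
  ind-mono {false} b⇒c = z≤n
  ind-mono {true}  b⇒c = ≤-reflexive (cong ind (sym (b⇒c refl)))

  ind-mono⁻¹ : ∀ {b c} → ind b ≤ ind c → b ≡ true → c ≡ true
  ind-mono⁻¹ {c = true} _ _ = refl
  ind-mono⁻¹ {true} {false} () refl

  count-mono : {P Q : Subset n → Bool} → (∀ E → P E ≡ true → Q E ≡ true) → count P ≤ count Q
  count-mono P⇒Q = total-mono (λ E → ind-mono (P⇒Q E))

  count-false : {P : Subset n → Bool} → (∀ E → P E ≡ false) → count P ≡ 0
  count-false {n} P≡f = trans (total-cong (cong ind ∘ P≡f)) (total-zero n)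

  private
    length-filter-++ : ∀ {A : Set} (P : A → Bool) xs ys →
      length (filterᵇ P (xs ++ ys)) ≡ length (filterᵇ P xs) + length (filterᵇ P ys)
    length-filter-++ P [] ys = refl
    length-filter-++ P (x ∷ xs) ys with P x
    ... | true  = cong suc (length-filter-++ P xs ys)
    ... | false = length-filter-++ P xs ys

    length-filter-map : ∀ {A B : Set} (P : B → Bool) (f : A → B) xs →
      length (filterᵇ P (map f xs)) ≡ length (filterᵇ (P ∘ f) xs)
    length-filter-map P f [] = refl
    length-filter-map P f (x ∷ xs) with P (f x)
    ... | true  = cong suc (length-filter-map P f xs)
    ... | false = length-filter-map P f xs

  length-filter-allSubsets : (P : Subset n → Bool) → length (filterᵇ P (allSubsets n)) ≡ count P
  length-filter-allSubsets {zero} P with P []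
  ... | true  = refl
  ... | false = refl
  length-filter-allSubsets {suc n} P = trans
    (length-filter-++ P (map (true ∷_) (allSubsets n)) _)
    (cong₂ _+_
      (trans (length-filter-map P (true ∷_) (allSubsets n)) (length-filter-allSubsets (P ∘ (true ∷_))))
      (trans (length-filter-map P (false ∷_) (allSubsets n)) (length-filter-allSubsets (P ∘ (false ∷_)))))

  sumOver : Subset n → (Fin n → ℕ) → ℕ
  sumOver []          g = 0
  sumOver (true ∷ A)  g = g zero + sumOver A (g ∘ suc)
  sumOver (false ∷ A) g = sumOver A (g ∘ suc)

  sumOver-≤ : (A : Subset n) {g : Fin n → ℕ} {M : ℕ} →
    (∀ a → lookup A a ≡ true → g a ≤ M) → sumOver A g ≤ ∣ A ∣ * M
  sumOver-≤ []          g≤M = z≤n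
  sumOver-≤ (true ∷ A)  g≤M = +-mono-≤ (g≤M zero refl) (sumOver-≤ A (g≤M ∘ suc))
  sumOver-≤ (false ∷ A) g≤M = sumOver-≤ A (g≤M ∘ suc)

  sumOver-∈ : (A : Subset n) (g : Fin n → ℕ) (a : Fin n) → lookup A a ≡ true → g a ≤ sumOver A g
  sumOver-∈ (true ∷ A)  g zero    _   = m≤m+n _ _
  sumOver-∈ (true ∷ A)  g (suc a) a∈A = ≤-trans (sumOver-∈ A (g ∘ suc) a a∈A) (m≤n+m _ _)
  sumOver-∈ (false ∷ A) g (suc a) a∈A = sumOver-∈ A (g ∘ suc) a a∈A

  total-sumOver : (A : Subset n) (g : Fin n → Subset m → ℕ) →
    total (λ E → sumOver A (λ a → g a E)) ≡ sumOver A (λ a → total (g a))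
  total-sumOver {m = m} []  g = total-zero m
  total-sumOver (true ∷ A)  g = trans (total-+ (g zero) _) (cong (total (g zero) +_) (total-sumOver A (g ∘ suc)))
  total-sumOver (false ∷ A) g = total-sumOver A (g ∘ suc)

  -- The indicator of P is at most the sum over A of the indicators of `Q a`, and the two sums are
  -- exchanged. It is applied with A a member of the family, so that every use costs a factor r.
  union-bound : (A : Subset n) {P : Subset m → Bool} (Q : Fin n → Subset m → Bool) {M : ℕ} →
    (∀ E → P E ≡ true → ∃ λ a → lookup A a ≡ true × Q a E ≡ true) →
    (∀ a → lookup A a ≡ true → count (Q a) ≤ M) → count P ≤ ∣ A ∣ * M
  union-bound A {P} Q {M} cover Q≤M = begin
    count P                                   ≤⟨ total-mono pointwise ⟩
    total (λ E → sumOver A (λ a → ind (Q a E))) ≡⟨ total-sumOver A (λ a → ind ∘ Q a) ⟩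
    sumOver A (λ a → count (Q a))             ≤⟨ sumOver-≤ A Q≤M ⟩
    ∣ A ∣ * M                                  ∎
    where
    open ≤-Reasoning
    pointwise : ∀ E → ind (P E) ≤ sumOver A (λ a → ind (Q a E))
    pointwise E with P E in eq
    ... | false = z≤n
    ... | true with cover E eq
    ...   | a , a∈A , QaE = ≤-trans (≤-reflexive (cong ind (sym QaE))) (sumOver-∈ A (λ a → ind (Q a E)) a a∈A)

  -- Prescribed membership at some points; `nothing` leaves a point unconstrained.
  Pattern : ℕ → Set
  Pattern = Vec (Maybe Bool)

  infix 5 _⇔ᵇ_
  _⇔ᵇ_ : Bool → Bool → Bool
  b ⇔ᵇ e = if b then e else not e

  matches : Pattern n → Subset n → Bool
  matches []            []      = true
  matches (nothing ∷ p) (_ ∷ E) = matches p E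
  matches (just b ∷ p)  (e ∷ E) = (b ⇔ᵇ e) ∧ matches p E

  ones free : Pattern n → ℕ
  ones []            = 0
  ones (nothing ∷ p) = ones p
  ones (just b ∷ p)  = ind b + ones p
  free []            = 0
  free (nothing ∷ p) = suc (free p)
  free (just _ ∷ p)  = free p

  private
    undersized : (p : Pattern n) {k : ℕ} → k < ones p → ∀ E → matches p E ∧ (∣ E ∣ ≡ᵇ k) ≡ false
    undersized (nothing ∷ p)    k<            (false ∷ E) = undersized p k< E
    undersized (nothing ∷ p) {zero} k<        (true ∷ E)  = trans (∧-comm (matches p E) false) refl
    undersized (nothing ∷ p) {suc k} k<       (true ∷ E)  = undersized p (<-trans (n<1+n k) k<) E
    undersized (just true ∷ p)  k<            (false ∷ E) = refl
    undersized (just true ∷ p)  {zero} k<     (true ∷ E)  = trans (∧-comm (matches p E) false) refl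
    undersized (just true ∷ p)  {suc k} (s≤s k<) (true ∷ E) = undersized p k< E
    undersized (just false ∷ p) k<            (true ∷ E)  = refl
    undersized (just false ∷ p) k<            (false ∷ E) = undersized p k< E

  -- At an unconstrained head, splitting by membership of the head is Pascal's rule. For s = 0 the
  -- half containing the head is empty: the forced points already use up the whole size, which is
  -- `undersized`.
  count-matches : (p : Pattern n) (s : ℕ) →
    count (λ E → matches p E ∧ (∣ E ∣ ≡ᵇ ones p + s)) ≡ free p choose s
  count-matches []               zero    = refl
  count-matches []               (suc s) = refl
  count-matches {suc n} (just true ∷ p) s = trans
    (cong₂ _+_ (count-matches p s) (total-zero n)) (+-identityʳ _)
  count-matches {suc n} (just false ∷ p) s = trans
    (cong (_+ total (λ E → ind (matches p E ∧ (∣ E ∣ ≡ᵇ ones p + s)))) (total-zero n))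
    (count-matches p s)
  count-matches (nothing ∷ p)    zero    = cong₂ _+_ (count-false no-room) (count-matches p zero)
    where
    no-room : ∀ E → matches p E ∧ (suc ∣ E ∣ ≡ᵇ ones p + 0) ≡ false
    no-room E with ones p in eq
    ... | zero  = ∧-comm (matches p E) false
    ... | suc k = subst (λ j → matches p E ∧ (∣ E ∣ ≡ᵇ j) ≡ false) (sym (+-identityʳ k))
                    (undersized p (≤-reflexive (sym eq)) E)
  count-matches (nothing ∷ p)    (suc s) = trans
    (cong₂ _+_
      (trans (total-cong (λ E → cong (λ k → ind (matches p E ∧ (suc ∣ E ∣ ≡ᵇ k))) (+-suc (ones p) s)))
        (count-matches p s))
      (count-matches p (suc s)))
    (nCk+nC[k+1]≡[n+1]C[k+1] (free p) s)

  matches-update : (p : Pattern n) (x : Fin n) (b : Bool) → lookup p x ≡ nothing →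
    ∀ E → matches (p [ x ]≔ just b) E ≡ (b ⇔ᵇ lookup E x) ∧ matches p E
  matches-update (nothing ∷ p) zero    b px (e ∷ E) = refl
  matches-update (nothing ∷ p) (suc x) b px (e ∷ E) = matches-update p x b px E
  matches-update (just c ∷ p)  (suc x) b px (e ∷ E) = begin
    (c ⇔ᵇ e) ∧ matches (p [ x ]≔ just b) E          ≡⟨ cong ((c ⇔ᵇ e) ∧_) (matches-update p x b px E) ⟩
    (c ⇔ᵇ e) ∧ ((b ⇔ᵇ lookup E x) ∧ matches p E)    ≡⟨ ∧-assoc (c ⇔ᵇ e) _ _ ⟨
    ((c ⇔ᵇ e) ∧ (b ⇔ᵇ lookup E x)) ∧ matches p E    ≡⟨ cong (_∧ matches p E) (∧-comm (c ⇔ᵇ e) _) ⟩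
    ((b ⇔ᵇ lookup E x) ∧ (c ⇔ᵇ e)) ∧ matches p E    ≡⟨ ∧-assoc (b ⇔ᵇ lookup E x) _ _ ⟩
    (b ⇔ᵇ lookup E x) ∧ ((c ⇔ᵇ e) ∧ matches p E)    ∎
    where open ≡-Reasoning

  ones-update : (p : Pattern n) (x : Fin n) (b : Bool) → lookup p x ≡ nothing →
    ones (p [ x ]≔ just b) ≡ ind b + ones p
  ones-update (nothing ∷ p) zero    b px = refl
  ones-update (nothing ∷ p) (suc x) b px = ones-update p x b px
  ones-update (just c ∷ p)  (suc x) b px = trans
    (cong (ind c +_) (ones-update p x b px)) (x+[y+z]≡y+[x+z] (ind c) (ind b) (ones p))
    where
    x+[y+z]≡y+[x+z] : ∀ x y z → x + (y + z) ≡ y + (x + z)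
    x+[y+z]≡y+[x+z] = solve-∀

  free-update : (p : Pattern n) (x : Fin n) (b : Bool) → lookup p x ≡ nothing →
    suc (free (p [ x ]≔ just b)) ≡ free p
  free-update (nothing ∷ p) zero    b px = refl
  free-update (nothing ∷ p) (suc x) b px = cong suc (free-update p x b px)
  free-update (just c ∷ p)  (suc x) b px = free-update p x b px

  private
    blank : ∀ n → Pattern n
    blank n = replicate n nothing

    matches-blank : (E : Subset n) → matches (blank n) E ≡ true
    matches-blank []      = refl
    matches-blank (_ ∷ E) = matches-blank E

    ones-blank : ∀ n → ones (blank n) ≡ 0
    ones-blank zero    = refl
    ones-blank (suc n) = ones-blank n

    free-blank : ∀ n → free (blank n) ≡ n
    free-blank zero    = refl
    free-blank (suc n) = cong suc (free-blank n)

  -- The point z stands outermost because each `matches-update` puts its new condition in front.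
  -- With literal bits the conjunction reduces to the exact shape of the truth tables used for the
  -- triangle family.
  class : (x y z : Fin n) (bx by bz : Bool) → ℕ → Subset n → Bool
  class x y z bx by bz k E = (bz ⇔ᵇ lookup E z) ∧ ((by ⇔ᵇ lookup E y) ∧ ((bx ⇔ᵇ lookup E x) ∧ (∣ E ∣ ≡ᵇ k)))

  -- The size is spelled out through the bits so that it reduces: three forced points with s, and
  -- two forced points with `suc s`, both give r = 3 + s.
  count-class : {x y z : Fin (3 + m)} → x ≢ y → x ≢ z → y ≢ z → (bx by bz : Bool) (s : ℕ) →
    count (class x y z bx by bz (ind bz + (ind by + (ind bx + s)))) ≡ m choose s
  count-class {m} {x} {y} {z} x≢y x≢z y≢z bx by bz s = begin
    count (class x y z bx by bz (ind bz + (ind by + (ind bx + s)))) ≡⟨ total-cong (cong ind ∘ agree) ⟩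
    count (λ E → matches p₃ E ∧ (∣ E ∣ ≡ᵇ ones p₃ + s))               ≡⟨ count-matches p₃ s ⟩
    free p₃ choose s                                                 ≡⟨ cong (_choose s) free≡m ⟩
    m choose s                                                       ∎
    where
    open ≡-Reasoning
    p₀ p₁ p₂ p₃ : Pattern (3 + m)
    p₀ = blank (3 + m)
    p₁ = p₀ [ x ]≔ just bx
    p₂ = p₁ [ y ]≔ just by
    p₃ = p₂ [ z ]≔ just bz
    p₀x : lookup p₀ x ≡ nothing
    p₀x = lookup-replicate x nothing
    p₁y : lookup p₁ y ≡ nothing
    p₁y = trans (lookup∘update′ (x≢y ∘ sym) p₀ (just bx)) (lookup-replicate y nothing)
    p₂z : lookup p₂ z ≡ nothing
    p₂z = trans (lookup∘update′ (y≢z ∘ sym) p₁ (just by))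
      (trans (lookup∘update′ (x≢z ∘ sym) p₀ (just bx)) (lookup-replicate z nothing))
    free≡m : free p₃ ≡ m
    free≡m = suc-injective (suc-injective (suc-injective (begin
      3 + free p₃ ≡⟨ cong (2 +_) (free-update p₂ z bz p₂z) ⟩
      2 + free p₂ ≡⟨ cong (1 +_) (free-update p₁ y by p₁y) ⟩
      1 + free p₁ ≡⟨ free-update p₀ x bx p₀x ⟩
      free p₀     ≡⟨ free-blank (3 + m) ⟩
      3 + m       ∎)))
    ones≡ : ones p₃ + s ≡ ind bz + (ind by + (ind bx + s))
    ones≡ = begin
      ones p₃ + s ≡⟨ cong (_+ s) (trans (ones-update p₂ z bz p₂z) (cong (ind bz +_)
                       (trans (ones-update p₁ y by p₁y) (cong (ind by +_)
                       (trans (ones-update p₀ x bx p₀x) (cong (ind bx +_) (ones-blank (3 + m)))))))) ⟩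
      ind bz + (ind by + (ind bx + 0)) + s ≡⟨ reassoc (ind bz) (ind by) (ind bx) s ⟩
      ind bz + (ind by + (ind bx + s)) ∎
      where
      reassoc : ∀ a b c s → a + (b + (c + 0)) + s ≡ a + (b + (c + s))
      reassoc = solve-∀
    agree : ∀ E → class x y z bx by bz (ind bz + (ind by + (ind bx + s))) E
                  ≡ matches p₃ E ∧ (∣ E ∣ ≡ᵇ ones p₃ + s)
    agree E rewrite ones≡ | matches-update p₂ z bz p₂z E | matches-update p₁ y by p₁y E
                  | matches-update p₀ x bx p₀x E | matches-blank E
                  with bz ⇔ᵇ lookup E z | by ⇔ᵇ lookup E y | bx ⇔ᵇ lookup E x
    ... | false | _     | _     = refl
    ... | true  | false | _     = refl
    ... | true  | true  | false = refl
    ... | true  | true  | true  = refl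

  card≡count : (F : Family n) → card F ≡ count F
  card≡count F = length-filter-allSubsets F

  deg≡count : (F : Family n) (x : Fin n) → deg F x ≡ count (λ E → F E ∧ lookup E x)
  deg≡count F x = trans (length-filter-allSubsets (λ E → if F E then lookup E x else false)) (total-cong same)
    where
    same : ∀ E → ind (if F E then lookup E x else false) ≡ ind (F E ∧ lookup E x)
    same E with F E
    ... | true  = refl
    ... | false = refl

  deg≤Δ : (F : Family n) (x : Fin n) → deg F x ≤ Δ F
  deg≤Δ {n} F x = go (allFin n) (∈-allFin x)
    where
    go : ∀ xs → x ∈ xs → deg F x ≤ foldr (λ y k → deg F y ⊔ k) 0 xs
    go (y ∷ xs) (here refl) = m≤m⊔n _ _
    go (y ∷ xs) (there x∈)  = ≤-trans (go xs x∈) (m≤n⊔m (deg F y) _)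

  Δ≤ : (F : Family n) {M : ℕ} → (∀ x → deg F x ≤ M) → Δ F ≤ M
  Δ≤ {n} F {M} deg≤M = go (allFin n)
    where
    go : ∀ xs → foldr (λ y k → deg F y ⊔ k) 0 xs ≤ M
    go []       = z≤n
    go (y ∷ xs) = ⊔-lub (deg≤M y) (go xs)

  count-⊎ : {P Q R : Subset n → Bool} →
    (∀ E → P E ≡ true → Q E ≡ true ⊎ R E ≡ true) → count P ≤ count Q + count R
  count-⊎ {P = P} {Q} {R} split = ≤-trans (total-mono pointwise) (≤-reflexive (total-+ (ind ∘ Q) (ind ∘ R)))
    where
    pointwise : ∀ E → ind (P E) ≤ ind (Q E) + ind (R E)
    pointwise E with P E in eq
    ... | false = z≤n
    ... | true with split E eq
    ...   | inj₁ q rewrite q = m≤m+n 1 _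
    ...   | inj₂ r rewrite r = m≤n+m 1 _

-- Heavy pairs and the dichotomy between star and triangle

module HeavyPairs where

  open Counting
  open import Data.Bool using (Bool; true; false; not; _∧_; _∨_)
  open import Data.Bool.Properties using (∧-conicalˡ; ∧-conicalʳ)
  import Data.Bool.Properties as Bool
  open import Data.Empty using (⊥; ⊥-elim)
  open import Data.Fin using (Fin)
  import Data.Fin as Fin
  import Data.Fin.Properties as Fin
  open import Data.Fin.Subset using (Subset)
  open import Data.Fin.Subset.Properties using (x∈p∩q⁻; anySubset?)
  open import Data.Nat
  open import Data.Nat.Properties
  open import Data.Product using (∃; _×_; _,_; proj₁; proj₂)
  open import Data.Sum using (_⊎_; inj₁; inj₂)
  open import Data.Vec using (lookup)
  open import Data.Vec.Properties using ([]=⇒lookup)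
  open import Function using (_∘_)
  open import Function.Bundles using (module Equivalence)
  open import Relation.Binary.PropositionalEquality
  open import Relation.Nullary using (¬_; Dec; yes; no; does; ¬?)
  open import Relation.Nullary.Decidable using (_×-dec_; dec-false; decidable-stable)

  ∧⁺ : ∀ {a b} → a ≡ true → b ≡ true → a ∧ b ≡ true
  ∧⁺ refl refl = refl

  ∧⁻ : ∀ a {b} → a ∧ b ≡ true → a ≡ true × b ≡ true
  ∧⁻ a {b} ab = ∧-conicalˡ a b ab , ∧-conicalʳ a b ab

  true≢false : ∀ {b} → b ≡ true → b ≡ false → ⊥
  true≢false refl ()

  exactlyTwo allThree atLeastTwo : Bool → Bool → Bool → Bool
  exactlyTwo true  y z = (y ∧ not z) ∨ (not y ∧ z)
  exactlyTwo false y z = y ∧ z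
  allThree x y z = x ∧ (y ∧ z)
  atLeastTwo true  y z = y ∨ z
  atLeastTwo false y z = y ∧ z

  -- A set meeting all three sides of a triangle misses at most one vertex.
  atLeastTwo⁺ : ∀ {x y z} → x ≡ true ⊎ y ≡ true → y ≡ true ⊎ z ≡ true → x ≡ true ⊎ z ≡ true →
    atLeastTwo x y z ≡ true
  atLeastTwo⁺ {true}  {true}  _ _ _ = refl
  atLeastTwo⁺ {true}  {false} _ (inj₂ z) _ = z
  atLeastTwo⁺ {false} (inj₂ refl) _ (inj₂ z) = z

  ≡ᵇ⁺ : ∀ {k l} → k ≡ l → (k ≡ᵇ l) ≡ true
  ≡ᵇ⁺ {k} {l} k≡l = Equivalence.to Bool.T-≡ (≡⇒≡ᵇ k l k≡l)

  ≡ᵇ⁻ : ∀ {k l} → (k ≡ᵇ l) ≡ true → k ≡ l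
  ≡ᵇ⁻ {k} {l} eq = ≡ᵇ⇒≡ k l (Equivalence.from Bool.T-≡ eq)

  module _ {n r N₃ : ℕ} (2≤r : 2 ≤ r)
    (count-triple : ∀ {x y z : Fin n} → x ≢ y → x ≢ z → y ≢ z → count (class x y z true true true r) ≤ N₃)
    (F : Family n) (uniform : Uniform r F) (intersecting : Intersecting F) where

    meet : ∀ {E A} → F E ≡ true → F A ≡ true → ∃ λ a → lookup A a ≡ true × lookup E a ≡ true
    meet {E} {A} FE FA with intersecting E A FE FA
    ... | a , a∈ with x∈p∩q⁻ E A a∈
    ...   | a∈E , a∈A = a , []=⇒lookup a∈A , []=⇒lookup a∈E

    triple-bound : ∀ {x y z} {P : Subset n → Bool} → x ≢ y → x ≢ z → y ≢ z →
      (∀ E → P E ≡ true → F E ≡ true × lookup E x ≡ true × lookup E y ≡ true × lookup E z ≡ true) →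
      count P ≤ N₃
    triple-bound {x} {y} {z} x≢y x≢z y≢z P⇒ = ≤-trans
      (count-mono λ E PE → let FE , Ex , Ey , Ez = P⇒ E PE in
        ∧⁺ Ez (∧⁺ Ey (∧⁺ Ex (≡ᵇ⁺ (uniform E FE)))))
      (count-triple x≢y x≢z y≢z)

    codeg : Fin n → Fin n → ℕ
    codeg x y = count (λ E → F E ∧ (lookup E x ∧ lookup E y))

    Heavy : Fin n → Fin n → Set
    Heavy x y = x ≢ y × r * N₃ < codeg x y

    heavy? : ∀ x y → Dec (Heavy x y)
    heavy? x y = ¬? (x Fin.≟ y) ×-dec (r * N₃ <? codeg x y)

    heavy-sym : ∀ {x y} → Heavy x y → Heavy y x
    heavy-sym {x} {y} (x≢y , h) = x≢y ∘ sym , <-≤-trans h (count-mono swapped)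
      where
      swapped : ∀ E → F E ∧ (lookup E x ∧ lookup E y) ≡ true → F E ∧ (lookup E y ∧ lookup E x) ≡ true
      swapped E eq = let FE , xy = ∧⁻ (F E) eq ; Ex , Ey = ∧⁻ (lookup E x) xy in ∧⁺ FE (∧⁺ Ey Ex)

    -- A member A missing both x and y meets every member through x and y in a third point, leaving room
    -- for at most r N₃ of those.
    heavy-covers : ∀ {x y A} → Heavy x y → F A ≡ true → lookup A x ≡ true ⊎ lookup A y ≡ true
    heavy-covers {x} {y} {A} (x≢y , h) FA with lookup A x in x∉A | lookup A y in y∉A
    ... | true  | _     = inj₁ refl
    ... | false | true  = inj₂ refl
    ... | false | false = ⊥-elim (<⇒≱ h (subst (λ k → codeg x y ≤ k * N₃) (uniform A FA)
            (union-bound A (λ a E → (F E ∧ (lookup E x ∧ lookup E y)) ∧ lookup E a) cover small)))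
      where
      cover : ∀ E → F E ∧ (lookup E x ∧ lookup E y) ≡ true →
        ∃ λ a → lookup A a ≡ true × (F E ∧ (lookup E x ∧ lookup E y)) ∧ lookup E a ≡ true
      cover E PE with meet (proj₁ (∧⁻ (F E) PE)) FA
      ... | a , a∈A , a∈E = a , a∈A , ∧⁺ PE a∈E
      small : ∀ a → lookup A a ≡ true → count (λ E → (F E ∧ (lookup E x ∧ lookup E y)) ∧ lookup E a) ≤ N₃
      small a a∈A = triple-bound x≢y (λ { refl → true≢false a∈A x∉A }) (λ { refl → true≢false a∈A y∉A })
        λ E QE → let PE , Ea = ∧⁻ (F E ∧ (lookup E x ∧ lookup E y)) QE
                     FE , xy = ∧⁻ (F E) PE
                     Ex , Ey = ∧⁻ (lookup E x) xy in FE , Ex , Ey , Ea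

    -- If the pairs were disjoint, every member through z and w would also pass through x or y,
    -- since the heavy pair {x, y} meets it. That leaves at most 2 N₃ ≤ r N₃ such members, too few
    -- for {z, w} to be heavy.
    heavy-intersect : ∀ {x y z w} → Heavy x y → Heavy z w → x ≢ z → x ≢ w → y ≡ z ⊎ y ≡ w
    heavy-intersect {x} {y} {z} {w} hxy (z≢w , h) x≢z x≢w with y Fin.≟ z | y Fin.≟ w
    ... | yes y≡z | _       = inj₁ y≡z
    ... | no _    | yes y≡w = inj₂ y≡w
    ... | no y≢z  | no y≢w  = ⊥-elim (<⇒≱ h (begin
        codeg z w                           ≤⟨ count-⊎ covered ⟩
        count (through x) + count (through y) ≤⟨ +-mono-≤ (small x≢z x≢w) (small y≢z y≢w) ⟩
        N₃ + N₃                              ≡⟨ cong (N₃ +_) (+-identityʳ N₃) ⟨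
        2 * N₃                              ≤⟨ *-monoˡ-≤ N₃ 2≤r ⟩
        r * N₃                              ∎))
      where
      open ≤-Reasoning
      through : Fin n → Subset n → Bool
      through v E = (F E ∧ (lookup E z ∧ lookup E w)) ∧ lookup E v
      covered : ∀ E → F E ∧ (lookup E z ∧ lookup E w) ≡ true → through x E ≡ true ⊎ through y E ≡ true
      covered E PE with heavy-covers hxy (proj₁ (∧⁻ (F E) PE))
      ... | inj₁ Ex = inj₁ (∧⁺ PE Ex)
      ... | inj₂ Ey = inj₂ (∧⁺ PE Ey)
      small : ∀ {v} → v ≢ z → v ≢ w → count (through v) ≤ N₃
      small v≢z v≢w = triple-bound v≢z v≢w z≢w
        λ E QE → let PE , Ev = ∧⁻ (F E ∧ (lookup E z ∧ lookup E w)) QE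
                     FE , zw = ∧⁻ (F E) PE
                     Ez , Ew = ∧⁻ (lookup E z) zw in FE , Ev , Ez , Ew

    ContainsHeavy : Subset n → Set
    ContainsHeavy E = ∃ λ x → ∃ λ y → Heavy x y × lookup E x ≡ true × lookup E y ≡ true

    containsHeavy? : ∀ E → Dec (ContainsHeavy E)
    containsHeavy? E = Fin.any? λ x → Fin.any? λ y →
      heavy? x y ×-dec (lookup E x Bool.≟ true) ×-dec (lookup E y Bool.≟ true)

    light : Subset n → Bool
    light E = F E ∧ not (does (containsHeavy? E))

    light⁻ : ∀ {E} → light E ≡ true → F E ≡ true × ¬ ContainsHeavy E
    light⁻ {E} eq with containsHeavy? E | ∧⁻ (F E) eq
    ... | no ¬h | FE , _ = FE , ¬h

    light⁺ : ∀ {E} → F E ≡ true → ¬ ContainsHeavy E → light E ≡ true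
    light⁺ {E} FE ¬h = ∧⁺ FE (cong not (dec-false (containsHeavy? E) ¬h))

    -- Every member meets A₀ in some x, and then a member A x avoiding x in some y ≠ x.
    count-light : ∀ {A₀} → F A₀ ≡ true → (∀ x → ∃ λ A → F A ≡ true × lookup A x ≡ false) →
      count light ≤ r * (r * (r * N₃))
    count-light {A₀} FA₀ avoid = subst (λ k → count light ≤ k * _) (uniform A₀ FA₀)
      (union-bound A₀ (λ x E → light E ∧ lookup E x) cover₀ (λ x _ → via x))
      where
      cover₀ : ∀ E → light E ≡ true → ∃ λ x → lookup A₀ x ≡ true × light E ∧ lookup E x ≡ true
      cover₀ E lE with meet (proj₁ (light⁻ lE)) FA₀
      ... | x , x∈A , x∈E = x , x∈A , ∧⁺ lE x∈E
      via : ∀ x → count (λ E → light E ∧ lookup E x) ≤ r * (r * N₃)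
      via x with avoid x
      ... | A , FA , x∉A = subst (λ k → count (λ E → light E ∧ lookup E x) ≤ k * _) (uniform A FA)
              (union-bound A (λ y E → (light E ∧ lookup E x) ∧ lookup E y) cover small)
        where
        cover : ∀ E → light E ∧ lookup E x ≡ true →
          ∃ λ y → lookup A y ≡ true × (light E ∧ lookup E x) ∧ lookup E y ≡ true
        cover E PE with meet (proj₁ (light⁻ (proj₁ (∧⁻ (light E) PE)))) FA
        ... | y , y∈A , y∈E = y , y∈A , ∧⁺ PE y∈E
        small : ∀ y → lookup A y ≡ true → count (λ E → (light E ∧ lookup E x) ∧ lookup E y) ≤ r * N₃
        -- A pair that is not heavy lies in at most r N₃ members; a heavy pair lies in no light
        -- member at all.
        small y y∈A with heavy? x y
        ... | no ¬h = ≤-trans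
                (count-mono λ E QE → let PE , Ey = ∧⁻ (light E ∧ lookup E x) QE ; lE , Ex = ∧⁻ (light E) PE in
                  ∧⁺ (proj₁ (light⁻ lE)) (∧⁺ Ex Ey))
                (≮⇒≥ (λ h → ¬h ((λ { refl → true≢false y∈A x∉A }) , h)))
        ... | yes h = ≤-trans
                (≤-reflexive (count-false λ E → Bool.¬-not (λ QE →
                  let PE , Ey = ∧⁻ (light E ∧ lookup E x) QE ; lE , Ex = ∧⁻ (light E) PE in proj₂ (light⁻ lE) (x , y , h , Ex , Ey))))
                z≤n

    -- A member that is not light contains a heavy pair and with it the centre, so `deg F a` counts
    -- it.
    star-bound : ∀ a → (∀ u v → Heavy u v → u ≡ a ⊎ v ≡ a) → card F ≤ Δ F + count light
    star-bound a centred = begin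
      card F                    ≡⟨ card≡count F ⟩
      count F                   ≤⟨ count-⊎ split ⟩
      count (λ E → F E ∧ lookup E a) + count light ≡⟨ cong (_+ count light) (deg≡count F a) ⟨
      deg F a + count light     ≤⟨ +-monoˡ-≤ _ (deg≤Δ F a) ⟩
      Δ F + count light         ∎
      where
      open ≤-Reasoning
      split : ∀ E → F E ≡ true → F E ∧ lookup E a ≡ true ⊎ light E ≡ true
      split E FE with containsHeavy? E in eq
      ... | no ¬h = inj₂ (∧⁺ FE refl)
      ... | yes (x , y , h , Ex , Ey) with centred x y h
      ...   | inj₁ refl = inj₁ (∧⁺ FE Ex)
      ...   | inj₂ refl = inj₁ (∧⁺ FE Ey)

    heavyAvoiding? : ∀ a → Dec (∃ λ u → ∃ λ v → Heavy u v × u ≢ a × v ≢ a)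
    heavyAvoiding? a = Fin.any? λ u → Fin.any? λ v →
      heavy? u v ×-dec ¬? (u Fin.≟ a) ×-dec ¬? (v Fin.≟ a)

    centred⁺ : ∀ {a} → ¬ (∃ λ u → ∃ λ v → Heavy u v × u ≢ a × v ≢ a) → ∀ u v → Heavy u v → u ≡ a ⊎ v ≡ a
    centred⁺ {a} none u v h with u Fin.≟ a | v Fin.≟ a
    ... | yes u≡a | _       = inj₁ u≡a
    ... | no _    | yes v≡a = inj₂ v≡a
    ... | no u≢a  | no v≢a  = ⊥-elim (none (u , v , h , u≢a , v≢a))

    Triangle : Set
    Triangle = ∃ λ a → ∃ λ b → ∃ λ c → Heavy a b × Heavy b c × Heavy a c

    -- A heavy pair avoiding b must meet {a, b} in a and {b, c} in c, so it is the pair {a, c}.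
    third-side : ∀ {a b c} → Heavy a b → Heavy b c → c ≢ a →
      (∃ λ u → ∃ λ v → Heavy u v × u ≢ b × v ≢ b) → Heavy a c
    third-side {a} {b} {c} ab bc c≢a (u , v , uv , u≢b , v≢b)
      with heavy-intersect (heavy-sym ab) uv (u≢b ∘ sym) (v≢b ∘ sym)
         | heavy-intersect bc uv (u≢b ∘ sym) (v≢b ∘ sym)
    ... | inj₁ refl | inj₁ refl = ⊥-elim (c≢a refl)
    ... | inj₁ refl | inj₂ refl = uv
    ... | inj₂ refl | inj₁ refl = heavy-sym uv
    ... | inj₂ refl | inj₂ refl = ⊥-elim (c≢a refl)

    triangle-from : ∀ {a b c} → Heavy a b → Heavy b c → c ≢ a → card F ≤ Δ F + count light ⊎ Triangle
    triangle-from {a} {b} {c} ab bc c≢a with heavyAvoiding? b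
    ... | no none = inj₁ (star-bound b (centred⁺ none))
    ... | yes uv  = inj₂ (a , b , c , ab , bc , third-side ab bc c≢a uv)

    -- Given a heavy pair {a, b}, either a is a centre or some heavy pair avoids a. The latter
    -- contains b, which produces a heavy path with middle b; then b is a centre, or a heavy pair
    -- avoiding b closes the path. With no heavy pair every member is light. Each alternative is
    -- settled by finite search, so the argument is constructive.
    star-or-triangle : card F ≤ Δ F + count light ⊎ Triangle
    star-or-triangle with Fin.any? (λ x → Fin.any? (heavy? x))
    ... | no none = inj₁ (≤-trans (≤-reflexive (card≡count F)) (≤-trans
            (count-mono {P = F} {light} (λ E FE → light⁺ FE λ { (u , v , h , _) → none (u , v , h) })) (m≤n+m _ (Δ F))))
    ... | yes (a , b , ab) with heavyAvoiding? a
    ...   | no none = inj₁ (star-bound a (centred⁺ none))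
    ...   | yes (u , v , uv , u≢a , v≢a) with heavy-intersect ab uv (u≢a ∘ sym) (v≢a ∘ sym)
    ...     | inj₁ refl = triangle-from ab uv v≢a
    ...     | inj₂ refl = triangle-from ab (heavy-sym uv) u≢a

    avoiding? : ∀ x → Dec (∃ λ A → F A ≡ true × lookup A x ≡ false)
    avoiding? x = anySubset? λ A → (F A Bool.≟ true) ×-dec (lookup A x Bool.≟ false)

    -- `count-light` needs a member to start from and, for every point, a member avoiding it. When
    -- one of these is missing the family is empty or has a point common to all members, and the
    -- first alternative holds outright.
    dichotomy : card F ≤ Δ F + r * (r * (r * N₃)) ⊎
      (∃ λ a → ∃ λ b → ∃ λ c → a ≢ b × a ≢ c × b ≢ c ×
        (∀ E → F E ≡ true → atLeastTwo (lookup E a) (lookup E b) (lookup E c) ≡ true))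
    dichotomy with anySubset? (λ A → F A Bool.≟ true)
    ... | no empty = inj₁ (≤-trans (≤-reflexive (trans (card≡count F)
            (count-false λ E → Bool.¬-not (λ FE → empty (E , FE))))) z≤n)
    ... | yes (A₀ , FA₀) with Fin.any? (λ x → ¬? (avoiding? x))
    ...   | yes (x , ¬avoid) = inj₁ (begin
              card F   ≡⟨ card≡count F ⟩
              count F  ≤⟨ count-mono (λ E FE → ∧⁺ FE (Bool.¬-not λ x∉E → ¬avoid (E , FE , x∉E))) ⟩
              count (λ E → F E ∧ lookup E x) ≡⟨ deg≡count F x ⟨
              deg F x  ≤⟨ deg≤Δ F x ⟩
              Δ F      ≤⟨ m≤m+n _ _ ⟩
              Δ F + r * (r * (r * N₃)) ∎)
      where open ≤-Reasoning
    ...   | no ¬universal with star-or-triangle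
    ...     | inj₁ f≤ = inj₁ (≤-trans f≤ (+-monoʳ-≤ (Δ F) (count-light FA₀ λ x →
                decidable-stable (avoiding? x) (λ ¬avoid → ¬universal (x , ¬avoid)))))
    ...     | inj₂ (a , b , c , ab , bc , ac) = inj₂ (a , b , c , proj₁ ab , proj₁ ac , proj₁ bc ,
                λ E FE → atLeastTwo⁺ (heavy-covers ab FE) (heavy-covers bc FE) (heavy-covers ac FE))

-- Comparisons with a real number as inequalities between natural numbers

module Cuts where

  open import Data.Empty using (⊥-elim)
  open import Data.Integer using (ℤ; +_; -[1+_]; +≤+; +<+)
  import Data.Integer as ℤ
  import Data.Integer.Properties as ℤ
  open import Data.Integer.Tactic.RingSolver using (solve-∀)
  open import Data.Nat using (ℕ; suc; z≤n)
  import Data.Nat as ℕ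
  import Data.Nat.Properties as ℕ
  import Data.Nat.Tactic.RingSolver as ℕ-Solver
  open import Data.Product using (∃; _×_; _,_; proj₁; proj₂)
  open import Data.Rational
  open import Data.Rational.Properties
  open import Data.Rational.Unnormalised using (mkℚᵘ; *≡*; *≤*) renaming (_≃_ to _≃ᵘ_)
  import Data.Rational.Unnormalised as ℚᵘ
  import Data.Rational.Unnormalised.Properties as ℚᵘ
  open import Data.Sum using (inj₁; inj₂)
  open import Relation.Binary.PropositionalEquality

  -- The fraction `⟦ n ⟧` is normalised by a gcd that does not compute for variable n; unnormalised
  -- rationals expose the numerator and denominator.
  toℚᵘ-⟦⟧ : ∀ n → toℚᵘ ⟦ n ⟧ ≃ᵘ mkℚᵘ (+ n) 0
  toℚᵘ-⟦⟧ n = toℚᵘ-fromℚᵘ (mkℚᵘ (+ n) 0)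

  toℚᵘ-⟦⟧-⟦⟧ : ∀ m n → toℚᵘ (⟦ m ⟧ - ⟦ n ⟧) ≃ᵘ mkℚᵘ (+ m ℤ.- + n) 0
  toℚᵘ-⟦⟧-⟦⟧ m n = begin
    toℚᵘ (⟦ m ⟧ - ⟦ n ⟧)                ≈⟨ toℚᵘ-homo-+ ⟦ m ⟧ (- ⟦ n ⟧) ⟩
    toℚᵘ ⟦ m ⟧ ℚᵘ.+ toℚᵘ (- ⟦ n ⟧)      ≈⟨ ℚᵘ.+-cong (toℚᵘ-⟦⟧ m) (toℚᵘ-homo‿- ⟦ n ⟧) ⟩
    mkℚᵘ (+ m) 0 ℚᵘ.- toℚᵘ ⟦ n ⟧        ≈⟨ ℚᵘ.+-congʳ (mkℚᵘ (+ m) 0) (ℚᵘ.-‿cong (toℚᵘ-⟦⟧ n)) ⟩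
    mkℚᵘ (+ m) 0 ℚᵘ.- mkℚᵘ (+ n) 0      ≈⟨ *≡* (identity (+ m) (ℤ.- + n)) ⟩
    mkℚᵘ (+ m ℤ.- + n) 0                ∎
    where
    open ℚᵘ.≃-Reasoning
    identity : ∀ x y → (x ℤ.* + 1 ℤ.+ y ℤ.* + 1) ℤ.* + 1 ≡ (x ℤ.+ y) ℤ.* + 1
    identity = solve-∀

  ⟦⟧-* : ∀ m n → ⟦ m ⟧ * ⟦ n ⟧ ≡ ⟦ m ℕ.* n ⟧
  ⟦⟧-* m n = toℚᵘ-injective (begin
    toℚᵘ (⟦ m ⟧ * ⟦ n ⟧)             ≈⟨ toℚᵘ-homo-* ⟦ m ⟧ ⟦ n ⟧ ⟩
    toℚᵘ ⟦ m ⟧ ℚᵘ.* toℚᵘ ⟦ n ⟧       ≈⟨ ℚᵘ.*-cong (toℚᵘ-⟦⟧ m) (toℚᵘ-⟦⟧ n) ⟩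
    mkℚᵘ (+ m) 0 ℚᵘ.* mkℚᵘ (+ n) 0   ≈⟨ *≡* (cong (ℤ._* + 1) (sym (ℤ.pos-* m n))) ⟩
    mkℚᵘ (+ (m ℕ.* n)) 0             ≈⟨ toℚᵘ-⟦⟧ (m ℕ.* n) ⟨
    toℚᵘ ⟦ m ℕ.* n ⟧                 ∎)
    where open ℚᵘ.≃-Reasoning

  -- The rational comparison (g − f) ≤ (u / (1 + d)) (x − y), with denominators cleared and all signs positive.
  module _ {u d : ℕ} {q : ℚ} (q≃ : toℚᵘ q ≃ᵘ mkℚᵘ (+ u) d) (g f x y : ℕ) where

    private
      rhs≃ : toℚᵘ (q * (⟦ x ⟧ - ⟦ y ⟧)) ≃ᵘ mkℚᵘ (+ u) d ℚᵘ.* mkℚᵘ (+ x ℤ.- + y) 0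
      rhs≃ = ℚᵘ.≃-trans (toℚᵘ-homo-* q (⟦ x ⟧ - ⟦ y ⟧)) (ℚᵘ.*-cong q≃ (toℚᵘ-⟦⟧-⟦⟧ x y))

      d* : + (suc d ℕ.* 1) ≡ + suc d
      d* = cong +_ (ℕ.*-identityʳ (suc d))

      -- Added to both sides, this moves every subtracted term across, so that each side becomes the
      -- image of a natural number.
      shift : ℤ
      shift = + suc d ℤ.* + f ℤ.+ + u ℤ.* + y

      left : (+ g ℤ.- + f) ℤ.* + (suc d ℕ.* 1) ℤ.+ shift ≡ + (suc d ℕ.* g ℕ.+ u ℕ.* y)
      left = begin
        (+ g ℤ.- + f) ℤ.* + (suc d ℕ.* 1) ℤ.+ shift ≡⟨ cong (λ k → (+ g ℤ.- + f) ℤ.* k ℤ.+ shift) d* ⟩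
        (+ g ℤ.- + f) ℤ.* + suc d ℤ.+ shift         ≡⟨ identity (+ g) (+ f) (+ suc d) (+ u ℤ.* + y) ⟩
        + suc d ℤ.* + g ℤ.+ + u ℤ.* + y             ≡⟨ cong₂ ℤ._+_ (ℤ.pos-* (suc d) g) (ℤ.pos-* u y) ⟨
        + (suc d ℕ.* g ℕ.+ u ℕ.* y)                 ∎
        where
        open ≡-Reasoning
        identity : ∀ g f d z → (g ℤ.- f) ℤ.* d ℤ.+ (d ℤ.* f ℤ.+ z) ≡ d ℤ.* g ℤ.+ z
        identity = solve-∀

      right : (+ u ℤ.* (+ x ℤ.- + y)) ℤ.* + 1 ℤ.+ shift ≡ + (u ℕ.* x ℕ.+ suc d ℕ.* f)
      right = begin
        (+ u ℤ.* (+ x ℤ.- + y)) ℤ.* + 1 ℤ.+ shift ≡⟨ identity (+ u) (+ x) (+ y) (+ suc d ℤ.* + f) ⟩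
        + u ℤ.* + x ℤ.+ + suc d ℤ.* + f           ≡⟨ cong₂ ℤ._+_ (ℤ.pos-* u x) (ℤ.pos-* (suc d) f) ⟨
        + (u ℕ.* x ℕ.+ suc d ℕ.* f)               ∎
        where
        open ≡-Reasoning
        identity : ∀ u x y z → (u ℤ.* (x ℤ.- y)) ℤ.* + 1 ℤ.+ (z ℤ.+ u ℤ.* y) ≡ u ℤ.* x ℤ.+ z
        identity = solve-∀

    clear-denominator : (⟦ g ⟧ - ⟦ f ⟧) ≤ q * (⟦ x ⟧ - ⟦ y ⟧) →
      suc d ℕ.* g ℕ.+ u ℕ.* y ℕ.≤ u ℕ.* x ℕ.+ suc d ℕ.* f
    clear-denominator h = ℤ.drop‿+≤+ (subst₂ ℤ._≤_ left right (ℤ.+-monoˡ-≤ shift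
      (ℚᵘ.drop-*≤* (ℚᵘ.≤-respˡ-≃ (toℚᵘ-⟦⟧-⟦⟧ g f) (ℚᵘ.≤-respʳ-≃ rhs≃ (toℚᵘ-mono-≤ h))))))

    clear-denominator⁻¹ : suc d ℕ.* g ℕ.+ u ℕ.* y ℕ.≤ u ℕ.* x ℕ.+ suc d ℕ.* f →
      (⟦ g ⟧ - ⟦ f ⟧) ≤ q * (⟦ x ⟧ - ⟦ y ⟧)
    clear-denominator⁻¹ h = toℚᵘ-cancel-≤
      (ℚᵘ.≤-respˡ-≃ (ℚᵘ.≃-sym (toℚᵘ-⟦⟧-⟦⟧ g f)) (ℚᵘ.≤-respʳ-≃ (ℚᵘ.≃-sym rhs≃) (*≤* unshifted)))
      where
      unshifted : (+ g ℤ.- + f) ℤ.* + (suc d ℕ.* 1) ℤ.≤ (+ u ℤ.* (+ x ℤ.- + y)) ℤ.* + 1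
      unshifted = subst₂ ℤ._≤_ (cancel _ shift) (cancel _ shift)
        (ℤ.+-monoˡ-≤ (ℤ.- shift) (subst₂ ℤ._≤_ (sym left) (sym right) (+≤+ h)))
        where
        cancel : ∀ a b → (a ℤ.+ b) ℤ.- b ≡ a
        cancel = solve-∀

  0≤⟦⟧-⟦⟧ : ∀ {x y} → y ℕ.≤ x → 0ℚ ≤ ⟦ x ⟧ - ⟦ y ⟧
  0≤⟦⟧-⟦⟧ {x} {y} y≤x = toℚᵘ-cancel-≤ (ℚᵘ.≤-respʳ-≃ (ℚᵘ.≃-sym (toℚᵘ-⟦⟧-⟦⟧ x y))
    (*≤* (subst (ℤ._≤_ (+ 0)) (sym (ℤ.*-identityʳ _)) (ℤ.i≤j⇒0≤j-i (+≤+ y≤x)))))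

  ⟦⟧-⟦⟧≤0 : ∀ {x y} → x ℕ.≤ y → ⟦ x ⟧ - ⟦ y ⟧ ≤ 0ℚ
  ⟦⟧-⟦⟧≤0 {x} {y} x≤y = toℚᵘ-cancel-≤ (ℚᵘ.≤-respˡ-≃ (ℚᵘ.≃-sym (toℚᵘ-⟦⟧-⟦⟧ x y))
    (*≤* (subst (ℤ._≤ + 0) (sym (ℤ.*-identityʳ _)) (ℤ.i≤j⇒i-j≤0 (+≤+ x≤y)))))

  module _ (C : ℝ) where

    up⇒1≤ : 1≤C C → ∀ {q} → Up C q → 1ℚ ≤ q
    up⇒1≤ 1≤ {q} up = subst (1ℚ ≤_) (*-identityʳ q) (proj₁ 1≤ q up (*≤* (+≤+ z≤n)))

    -- Locatedness leaves only `Up C 1ℚ` to exclude; upper cuts are open, so it would yield an upper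
    -- rational strictly below 1.
    <1⇒lo : 1≤C C → ∀ {p} → p < 1ℚ → Lo C p
    <1⇒lo 1≤ {p} p<1 with located C p 1ℚ p<1
    ... | inj₁ lo = lo
    ... | inj₂ up = let q , q<1 , up′ = up-round C 1ℚ up in ⊥-elim (<-irrefl {q} refl (<-≤-trans q<1 (up⇒1≤ 1≤ up′)))

    Cleared : (u d g f x y : ℕ) → Set
    Cleared u d g f x y = suc d ℕ.* g ℕ.+ u ℕ.* y ℕ.≤ u ℕ.* x ℕ.+ suc d ℕ.* f

    -- Openness of the upper cut leaves room for a rational strictly between C and 3/2. It depends
    -- on C alone, so its denominator may enter the threshold for n; strictness below 3/2 is what
    -- keeps 3 - 2q at least 1 / (1 + d).
    upper-slope : 1≤C C → C<3/2 C → ∃ λ u → ∃ λ d → suc d ℕ.≤ u × u ℕ.* 2 ℕ.< 3 ℕ.* suc d ×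
      (∀ g f x y → y ℕ.≤ x → (⟦ g ⟧ - ⟦ f ⟧) ≤ C · (⟦ x ⟧ - ⟦ y ⟧) → Cleared u d g f x y)
    upper-slope 1≤ <3/2 with up-round C _ <3/2
    ... | q , q<3/2 , up = from-numerator q up q<3/2 (up⇒1≤ 1≤ up)
      where
      from-numerator : ∀ q → Up C q → q < + 3 / 2 → 1ℚ ≤ q →
        ∃ λ u → ∃ λ d → suc d ℕ.≤ u × u ℕ.* 2 ℕ.< 3 ℕ.* suc d ×
        (∀ g f x y → y ℕ.≤ x → (⟦ g ⟧ - ⟦ f ⟧) ≤ C · (⟦ x ⟧ - ⟦ y ⟧) → Cleared u d g f x y)
      from-numerator q@(mkℚ (+ u) d _) up (*<* q<) (*≤* 1≤q) = u , d ,
        ℤ.drop‿+≤+ (subst₂ ℤ._≤_ (ℤ.*-identityˡ (+ suc d)) (ℤ.*-identityʳ (+ u)) 1≤q) ,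
        ℤ.drop‿+<+ (subst (ℤ._< + 3 ℤ.* + suc d) (sym (ℤ.pos-* u 2)) q<) ,
        λ g f x y y≤x h → clear-denominator ℚᵘ.≃-refl g f x y (proj₁ h q up (0≤⟦⟧-⟦⟧ y≤x))
      from-numerator (mkℚ -[1+ u ] d _) up _ (*≤* ())

    -- For C > 1 there is a rational strictly between 1 and C. It applies when Δ(F) ≥ 2N, and its
    -- excess over 1 is what rules out members containing the whole triangle.
    lower-slope : 1<C C → ∃ λ u → ∃ λ d → suc d ℕ.< u ×
      (∀ g f x y → x ℕ.≤ y → (⟦ g ⟧ - ⟦ f ⟧) ≤ C · (⟦ x ⟧ - ⟦ y ⟧) → Cleared u d g f x y)
    lower-slope 1< with lo-round C _ 1<
    ... | mkℚ (+ u) d c , *<* 1<q , lo = u , d ,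
        ℤ.drop‿+<+ (subst₂ ℤ._<_ (ℤ.*-identityˡ (+ suc d)) (ℤ.*-identityʳ (+ u)) 1<q) ,
        λ g f x y x≤y h → clear-denominator ℚᵘ.≃-refl g f x y (proj₂ h (mkℚ (+ u) d c) lo (⟦⟧-⟦⟧≤0 x≤y))
    ... | mkℚ -[1+ u ] d _ , *<* () , _

    -- With k = y − x, the rational slope k / (1 + k) < 1 is close enough to 1 for integrality to close the gap.
    unit-slope : 1≤C C → ∀ g f x y → x ℕ.≤ y → (⟦ g ⟧ - ⟦ f ⟧) ≤ C · (⟦ x ⟧ - ⟦ y ⟧) → g ℕ.+ y ℕ.≤ x ℕ.+ f
    unit-slope 1≤ g f x y x≤y h with ℕ.m≤n⇒∃[o]m+o≡n x≤y
    ... | k , refl = ℕ.≮⇒≥ λ x+f<g+y → ℕ.<⇒≱ (strict x+f<g+y) cleared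
      where
      p≃ : toℚᵘ (+ k / suc k) ≃ᵘ mkℚᵘ (+ k) k
      p≃ = toℚᵘ-fromℚᵘ (mkℚᵘ (+ k) k)
      p<1 : + k / suc k < 1ℚ
      p<1 = toℚᵘ-cancel-< (ℚᵘ.<-respˡ-≃ (ℚᵘ.≃-sym p≃) (ℚᵘ.*<* (subst₂ ℤ._<_
        (sym (ℤ.*-identityʳ (+ k))) (sym (ℤ.*-identityˡ (+ suc k))) (+<+ (ℕ.n<1+n k)))))
      -- In terms of fractions, g - f ≤ -k² / (1 + k) = -k + k / (1 + k), which misses the goal g -
      -- f ≤ -k by less than one.
      cleared : suc k ℕ.* g ℕ.+ k ℕ.* (x ℕ.+ k) ℕ.≤ k ℕ.* x ℕ.+ suc k ℕ.* f
      cleared = clear-denominator p≃ g f x (x ℕ.+ k)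
        (proj₂ h (+ k / suc k) (<1⇒lo 1≤ p<1) (⟦⟧-⟦⟧≤0 (ℕ.m≤m+n x k)))
      lhs-identity : ∀ f k x → suc k ℕ.* suc (x ℕ.+ f) ≡ suc (k ℕ.* x ℕ.+ suc k ℕ.* f) ℕ.+ (k ℕ.+ x)
      lhs-identity = ℕ-Solver.solve-∀
      rhs-identity : ∀ g k x → suc k ℕ.* (g ℕ.+ (x ℕ.+ k)) ≡ suc k ℕ.* g ℕ.+ k ℕ.* (x ℕ.+ k) ℕ.+ (k ℕ.+ x)
      rhs-identity = ℕ-Solver.solve-∀
      strict : suc (x ℕ.+ f) ℕ.≤ g ℕ.+ (x ℕ.+ k) →
        k ℕ.* x ℕ.+ suc k ℕ.* f ℕ.< suc k ℕ.* g ℕ.+ k ℕ.* (x ℕ.+ k)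
      strict lt = ℕ.+-cancelʳ-≤ (k ℕ.+ x) _ _ (subst₂ ℕ._≤_ (lhs-identity f k x) (rhs-identity g k x)
        (ℕ.*-monoʳ-≤ (suc k) lt))

    -- Slope 1 bounds C from below and slope 3/2 from above.
    from-slopes : 1≤C C → C<3/2 C → ∀ g f x y → g ℕ.+ y ℕ.≤ x ℕ.+ f → 2 ℕ.* g ℕ.+ 3 ℕ.* y ℕ.≤ 3 ℕ.* x ℕ.+ 2 ℕ.* f →
      (⟦ g ⟧ - ⟦ f ⟧) ≤ C · (⟦ x ⟧ - ⟦ y ⟧)
    from-slopes 1≤ <3/2 g f x y h₁ h₃₂ = above , below
      where
      above : ∀ q → Up C q → 0ℚ ≤ ⟦ x ⟧ - ⟦ y ⟧ → ⟦ g ⟧ - ⟦ f ⟧ ≤ q * (⟦ x ⟧ - ⟦ y ⟧)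
      above q up 0≤ = ≤-trans
        (clear-denominator⁻¹ {1} {0} {1ℚ} ℚᵘ.≃-refl g f x y (subst₂ ℕ._≤_
          (cong₂ ℕ._+_ (sym (ℕ.*-identityˡ g)) (sym (ℕ.*-identityˡ y)))
          (cong₂ ℕ._+_ (sym (ℕ.*-identityˡ x)) (sym (ℕ.*-identityˡ f))) h₁))
        (*-monoʳ-≤-nonNeg (⟦ x ⟧ - ⟦ y ⟧) {{nonNegative 0≤}} (up⇒1≤ 1≤ up))
      below : ∀ q → Lo C q → ⟦ x ⟧ - ⟦ y ⟧ ≤ 0ℚ → ⟦ g ⟧ - ⟦ f ⟧ ≤ q * (⟦ x ⟧ - ⟦ y ⟧)
      below q lo ≤0 = ≤-trans
        (clear-denominator⁻¹ {3} {1} {+ 3 / 2} ℚᵘ.≃-refl g f x y h₃₂)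
        (*-monoʳ-≤-nonPos (⟦ x ⟧ - ⟦ y ⟧) {{nonPositive ≤0}} (<⇒≤ q<3/2))
        where
        q<3/2 : q < + 3 / 2
        q<3/2 = ≰⇒> λ 3/2≤q → let q′ , q′<3/2 , up = up-round C _ <3/2 in
          disjoint C q (lo , up-up C q′ q (<-≤-trans q′<3/2 3/2≤q) up)

-- Growth of binomial coefficients and the inequalities of the extremal argument

module Arithmetic where

  open import Data.Nat
  open import Data.Nat.Combinatorics using (nC1≡n; nCk+nC[k+1]≡[n+1]C[k+1]) renaming (_C_ to _choose_)
  open import Data.Nat.Properties
  open import Data.Nat.Tactic.RingSolver using (solve-∀)
  open import Data.Product using (_×_; _,_)
  open import Relation.Binary.PropositionalEquality

  -- This is (s + 1) C(m, s + 1) = (m - s) C(m, s) with the subtraction moved across, so that it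
  -- holds for all m and s over the naturals.
  choose-absorb : ∀ m s → suc s * (m choose suc s) + s * (m choose s) ≡ m * (m choose s)
  choose-absorb zero    zero    = refl
  choose-absorb zero    (suc s) = cong₂ _+_ (*-zeroʳ s) (*-zeroʳ s)
  choose-absorb (suc m) zero    = trans (trans (+-identityʳ _) (*-identityˡ _))
    (trans (nC1≡n (suc m)) (sym (*-identityʳ (suc m))))
  choose-absorb (suc m) (suc s)
    rewrite sym (nCk+nC[k+1]≡[n+1]C[k+1] m s) | sym (nCk+nC[k+1]≡[n+1]C[k+1] m (suc s)) = begin
    (2 + s) * (B + D) + (1 + s) * (A + B)                           ≡⟨ regroup s A B D ⟩
    ((2 + s) * D + (1 + s) * B) + (((1 + s) * B + s * A) + (A + B)) ≡⟨ cong₂ (λ k l → k + (l + (A + B)))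
                                                                         (choose-absorb m (suc s)) (choose-absorb m s) ⟩
    m * B + (m * A + (A + B))                                       ≡⟨ collect m A B ⟩
    suc m * (A + B)                                                 ∎
    where
    open ≡-Reasoning
    A B D : ℕ
    A = m choose s
    B = m choose suc s
    D = m choose suc (suc s)
    regroup : ∀ s A B D → (2 + s) * (B + D) + (1 + s) * (A + B)
                        ≡ ((2 + s) * D + (1 + s) * B) + (((1 + s) * B + s * A) + (A + B))
    regroup = solve-∀
    collect : ∀ m A B → m * B + (m * A + (A + B)) ≡ suc m * (A + B)
    collect = solve-∀

  -- The ratio of consecutive coefficients is (m - s) / (s + 1), which is at least k exactly under
  -- this condition on m.
  choose-growth : ∀ k {m s} → s + suc s * k ≤ m → k * (m choose s) ≤ m choose suc s
  choose-growth k {m} {s} m-large = *-cancelˡ-≤ (suc s) (+-cancelʳ-≤ (s * A) _ _ (begin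
    suc s * (k * A) + s * A          ≡⟨ collect s k A ⟩
    (s + suc s * k) * A              ≤⟨ *-monoˡ-≤ A m-large ⟩
    m * A                            ≡⟨ choose-absorb m s ⟨
    suc s * (m choose suc s) + s * A ∎))
    where
    open ≤-Reasoning
    A : ℕ
    A = m choose s
    collect : ∀ s k A → suc s * (k * A) + s * A ≡ (s + suc s * k) * A
    collect = solve-∀

  choose-positive : ∀ {m s} → s ≤ m → 0 < m choose s
  choose-positive {s = zero} z≤n = s≤s z≤n
  choose-positive {suc m} {suc s} (s≤s s≤m) = ≤-trans (choose-positive s≤m)
    (≤-trans (m≤m+n (m choose s) _) (≤-reflexive (nCk+nC[k+1]≡[n+1]C[k+1] m s)))

  -- With q = u / (1 + d), optimality gives (3 - 2q) N ≤ f - qΔ ≤ e + (1 - q)Δ ≤ e, and 3 - 2q is a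
  -- positive multiple of 1 / (1 + d).
  star-small : ∀ {u d N f Δ e} → suc d ≤ u → u * 2 < 3 * suc d → Δ ≤ 2 * N → f ≤ Δ + e →
    suc d * (3 * N) + u * Δ ≤ u * (2 * N) + suc d * f → N ≤ suc d * e
  star-small {u} {d} {N} {f} {Δ} {e} d<u u< Δ≤ f≤ h = +-cancelʳ-≤ (u * 2 * N) _ _ (begin
    N + u * 2 * N                 ≤⟨ *-monoˡ-≤ N u< ⟩
    3 * suc d * N                 ≡⟨ cong (_* N) (*-comm 3 (suc d)) ⟩
    suc d * 3 * N                 ≡⟨ *-assoc (suc d) 3 N ⟩
    suc d * (3 * N)               ≤⟨ +-cancelʳ-≤ (u * Δ) _ _ (begin
        suc d * (3 * N) + u * Δ             ≤⟨ h ⟩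
        u * (2 * N) + suc d * f             ≤⟨ +-monoʳ-≤ (u * (2 * N)) (*-monoʳ-≤ (suc d) f≤) ⟩
        u * (2 * N) + suc d * (Δ + e)       ≡⟨ cong (u * (2 * N) +_) (*-distribˡ-+ (suc d) Δ e) ⟩
        u * (2 * N) + (suc d * Δ + suc d * e) ≤⟨ +-monoʳ-≤ (u * (2 * N)) (+-monoˡ-≤ (suc d * e) (*-monoˡ-≤ Δ d<u)) ⟩
        u * (2 * N) + (u * Δ + suc d * e)   ≡⟨ rotate (u * (2 * N)) (u * Δ) (suc d * e) ⟩
        (suc d * e + u * (2 * N)) + u * Δ   ∎) ⟩
    suc d * e + u * (2 * N)       ≡⟨ cong (suc d * e +_) (*-assoc u 2 N) ⟨
    suc d * e + u * 2 * N         ∎)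
    where
    open ≤-Reasoning
    rotate : ∀ x y z → x + (y + z) ≡ (z + x) + y
    rotate = solve-∀

  star-small′ : ∀ {N f Δ e} → f ≤ Δ + e → 3 * N + Δ ≤ 2 * N + f → N ≤ e
  star-small′ {N} {f} {Δ} {e} f≤ h = +-cancelʳ-≤ (2 * N + Δ) _ _ (begin
    N + (2 * N + Δ)   ≡⟨ +-assoc N (2 * N) Δ ⟨
    3 * N + Δ         ≤⟨ h ⟩
    2 * N + f         ≤⟨ +-monoʳ-≤ (2 * N) f≤ ⟩
    2 * N + (Δ + e)   ≡⟨ rotate (2 * N) Δ e ⟩
    e + (2 * N + Δ)   ∎)
    where
    open ≤-Reasoning
    rotate : ∀ x y z → x + (y + z) ≡ z + (x + y)
    rotate = solve-∀

  -- α and τ count the members meeting the triangle in exactly two and in all three vertices.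
  module _ {α τ Δ : ℕ} (degrees : 2 * α + 3 * τ ≤ 3 * Δ) where

    -- The diversity bound is affine in C, so its endpoints suffice. At C = 1 it reads |F| - Δ ≤ N,
    -- from 3(α + τ) = (2α + 3τ) + α ≤ 3Δ + 3N.
    slope-one : ∀ {N} → α ≤ 3 * N → (α + τ) + 2 * N ≤ Δ + 3 * N
    slope-one {N} α≤ = *-cancelˡ-≤ 3 (begin
      3 * ((α + τ) + 2 * N)             ≡⟨ split α τ N ⟩
      (2 * α + 3 * τ) + α + 6 * N       ≤⟨ +-monoˡ-≤ (6 * N) (+-mono-≤ degrees α≤) ⟩
      3 * Δ + 3 * N + 6 * N             ≡⟨ join Δ N ⟩
      3 * (Δ + 3 * N)                   ∎)
      where
      open ≤-Reasoning
      split : ∀ α τ N → 3 * ((α + τ) + 2 * N) ≡ (2 * α + 3 * τ) + α + 6 * N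
      split = solve-∀
      join : ∀ Δ N → 3 * Δ + 3 * N + 6 * N ≡ 3 * (Δ + 3 * N)
      join = solve-∀

    -- The other endpoint, where the bound is zero: 2|F| ≤ 2α + 3τ ≤ 3Δ.
    slope-three-halves : ∀ N → 2 * (α + τ) + 3 * (2 * N) ≤ 3 * Δ + 2 * (3 * N)
    slope-three-halves N = begin
      2 * (α + τ) + 3 * (2 * N)         ≤⟨ m≤m+n _ τ ⟩
      2 * (α + τ) + 3 * (2 * N) + τ     ≡⟨ split α τ N ⟩
      (2 * α + 3 * τ) + 2 * (3 * N)     ≤⟨ +-monoˡ-≤ (2 * (3 * N)) degrees ⟩
      3 * Δ + 2 * (3 * N)               ∎
      where
      open ≤-Reasoning
      split : ∀ α τ N → 2 * (α + τ) + 3 * (2 * N) + τ ≡ (2 * α + 3 * τ) + 2 * (3 * N)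
      split = solve-∀

    -- Write Δ = 2N - y and q = u / (1 + d). The degrees force |F| ≤ 3N - 3y/2 - τ/2, whereas the
    -- smaller maximum degree makes up for a loss of at most qy. As q < 3/2, both y and τ vanish.
    extremal-below : ∀ {u d N} → u * 2 < 3 * suc d → Δ ≤ 2 * N →
      suc d * (3 * N) + u * Δ ≤ u * (2 * N) + suc d * (α + τ) → 3 * N ≤ α × τ ≡ 0
    extremal-below {u} {d} {N} u< Δ≤ h with m≤n⇒∃[o]m+o≡n Δ≤
    ... | y , Δ+y≡2N = 3N≤α , τ≡0
      where
      open ≤-Reasoning
      expand : ∀ e Δ y u τ → e * (3 * (Δ + y)) + 2 * (u * Δ) + e * τ ≡ (3 * e * y + e * τ) + (3 * e * Δ + 2 * (u * Δ))
      expand = solve-∀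
      double : ∀ e N u Δ τ → e * (3 * (2 * N)) + 2 * (u * Δ) + e * τ ≡ 2 * (e * (3 * N) + u * Δ) + e * τ
      double = solve-∀
      collect : ∀ u N e α τ → 2 * (u * (2 * N) + e * (α + τ)) + e * τ ≡ 2 * (u * (2 * N)) + e * (2 * α + 3 * τ)
      collect = solve-∀
      finish : ∀ u e Δ y → 2 * (u * (Δ + y)) + e * (3 * Δ) ≡ u * 2 * y + (3 * e * Δ + 2 * (u * Δ))
      finish = solve-∀
      key : 3 * suc d * y + suc d * τ ≤ u * 2 * y
      key = +-cancelʳ-≤ (3 * suc d * Δ + 2 * (u * Δ)) _ _ (begin
        (3 * suc d * y + suc d * τ) + (3 * suc d * Δ + 2 * (u * Δ)) ≡⟨ expand (suc d) Δ y u τ ⟨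
        suc d * (3 * (Δ + y)) + 2 * (u * Δ) + suc d * τ  ≡⟨ cong (λ k → suc d * (3 * k) + 2 * (u * Δ) + suc d * τ) Δ+y≡2N ⟩
        suc d * (3 * (2 * N)) + 2 * (u * Δ) + suc d * τ  ≡⟨ double (suc d) N u Δ τ ⟩
        2 * (suc d * (3 * N) + u * Δ) + suc d * τ        ≤⟨ +-monoˡ-≤ (suc d * τ) (*-monoʳ-≤ 2 h) ⟩
        2 * (u * (2 * N) + suc d * (α + τ)) + suc d * τ  ≡⟨ collect u N (suc d) α τ ⟩
        2 * (u * (2 * N)) + suc d * (2 * α + 3 * τ)      ≤⟨ +-monoʳ-≤ (2 * (u * (2 * N))) (*-monoʳ-≤ (suc d) degrees) ⟩
        2 * (u * (2 * N)) + suc d * (3 * Δ)              ≡⟨ cong (λ k → 2 * (u * k) + suc d * (3 * Δ)) Δ+y≡2N ⟨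
        2 * (u * (Δ + y)) + suc d * (3 * Δ)              ≡⟨ finish u (suc d) Δ y ⟩
        u * 2 * y + (3 * suc d * Δ + 2 * (u * Δ))        ∎)
      slack : y + suc d * τ ≤ 0
      slack = +-cancelʳ-≤ (u * 2 * y) _ _ (begin
        y + suc d * τ + u * 2 * y   ≡⟨ shuffle y (suc d * τ) (u * 2 * y) ⟩
        y + u * 2 * y + suc d * τ   ≤⟨ +-monoˡ-≤ (suc d * τ) (*-monoˡ-≤ y u<) ⟩
        3 * suc d * y + suc d * τ   ≤⟨ key ⟩
        u * 2 * y                   ∎)
        where
        shuffle : ∀ x y z → x + y + z ≡ x + z + y
        shuffle = solve-∀
      y≡0 : y ≡ 0
      y≡0 = n≤0⇒n≡0 (≤-trans (m≤m+n y _) slack)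
      τ≡0 : τ ≡ 0
      τ≡0 = n≤0⇒n≡0 (≤-trans (m≤n*m τ (suc d)) (≤-trans (m≤n+m _ y) slack))
      Δ≡2N : Δ ≡ 2 * N
      Δ≡2N = trans (sym (trans (cong (Δ +_) y≡0) (+-identityʳ Δ))) Δ+y≡2N
      3N≤α : 3 * N ≤ α
      3N≤α = *-cancelˡ-≤ (suc d) (+-cancelʳ-≤ (u * (2 * N)) _ _ (begin
        suc d * (3 * N) + u * (2 * N)       ≡⟨ cong (λ k → suc d * (3 * N) + u * k) Δ≡2N ⟨
        suc d * (3 * N) + u * Δ             ≤⟨ h ⟩
        u * (2 * N) + suc d * (α + τ)       ≡⟨ cong (λ k → u * (2 * N) + suc d * k) (trans (cong (α +_) τ≡0) (+-identityʳ α)) ⟩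
        u * (2 * N) + suc d * α             ≡⟨ +-comm (u * (2 * N)) _ ⟩
        suc d * α + u * (2 * N)             ∎))

    -- Optimality at slope 1 gives N ≤ |F| - Δ, and the degrees give |F| - Δ ≤ α/3.
    extremal-above : ∀ {N} → 3 * N + Δ ≤ 2 * N + (α + τ) → 3 * N ≤ α
    extremal-above {N} h = +-cancelʳ-≤ (6 * N + 2 * α + 3 * τ) _ _ (begin
      3 * N + (6 * N + 2 * α + 3 * τ)      ≡⟨ split N α τ ⟩
      3 * (3 * N) + (2 * α + 3 * τ)        ≤⟨ +-monoʳ-≤ (3 * (3 * N)) degrees ⟩
      3 * (3 * N) + 3 * Δ                  ≡⟨ *-distribˡ-+ 3 (3 * N) Δ ⟨
      3 * (3 * N + Δ)                      ≤⟨ *-monoʳ-≤ 3 h ⟩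
      3 * (2 * N + (α + τ))                ≡⟨ join N α τ ⟩
      α + (6 * N + 2 * α + 3 * τ)          ∎)
      where
      open ≤-Reasoning
      split : ∀ N α τ → 3 * N + (6 * N + 2 * α + 3 * τ) ≡ 3 * (3 * N) + (2 * α + 3 * τ)
      split = solve-∀
      join : ∀ N α τ → 3 * (2 * N + (α + τ)) ≡ α + (6 * N + 2 * α + 3 * τ)
      join = solve-∀

    -- Once α = 3N, the degrees give Δ ≥ 2N + τ: the τ extra members gain τ in size but cost at
    -- least qτ with q > 1.
    no-triples : ∀ {u d N} → suc d < u → α ≡ 3 * N →
      suc d * (3 * N) + u * Δ ≤ u * (2 * N) + suc d * (α + τ) → τ ≡ 0
    no-triples {u} {d} {N} d<u refl h = n≤0⇒n≡0 (+-cancelʳ-≤ (suc d * τ) _ _ (begin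
      τ + suc d * τ    ≤⟨ *-monoˡ-≤ τ d<u ⟩
      u * τ            ≤⟨ +-cancelʳ-≤ (suc d * (3 * N) + u * (2 * N)) _ _ (begin
          u * τ + (suc d * (3 * N) + u * (2 * N))     ≡⟨ split u τ (suc d * (3 * N)) N ⟩
          suc d * (3 * N) + u * (2 * N + τ)           ≤⟨ +-monoʳ-≤ (suc d * (3 * N)) (*-monoʳ-≤ u 2N+τ≤Δ) ⟩
          suc d * (3 * N) + u * Δ                     ≤⟨ h ⟩
          u * (2 * N) + suc d * (3 * N + τ)           ≡⟨ join (u * (2 * N)) (suc d) (3 * N) τ ⟩
          suc d * τ + (suc d * (3 * N) + u * (2 * N)) ∎) ⟩
      suc d * τ        ∎))
      where
      open ≤-Reasoning
      triple : ∀ N τ → 3 * (2 * N + τ) ≡ 2 * (3 * N) + 3 * τ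
      triple = solve-∀
      2N+τ≤Δ : 2 * N + τ ≤ Δ
      2N+τ≤Δ = *-cancelˡ-≤ 3 (≤-trans (≤-reflexive (triple N τ)) degrees)
      split : ∀ u τ x N → u * τ + (x + u * (2 * N)) ≡ x + u * (2 * N + τ)
      split = solve-∀
      join : ∀ x d y τ → x + d * (y + τ) ≡ d * τ + (d * y + x)
      join = solve-∀

-- The triangle family, and families with at least two points in a triangle

module Triangles where

  open Counting
  open HeavyPairs
  open import Data.Bool using (Bool; true; false; not; _∧_)
  import Data.Bool.Properties as Bool
  open import Data.Fin using (Fin)
  import Data.Fin as Fin
  import Data.Fin.Properties as Fin
  open import Data.Fin.Subset using (Subset; ∣_∣)
  open import Data.Fin.Subset.Properties using (x∈p∩q⁺)
  open import Data.Nat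
  open import Data.Nat.Properties
  open import Data.Nat.Tactic.RingSolver using (solve-∀)
  open import Data.Product using (_×_; _,_; proj₁; proj₂)
  open import Data.Sum using (_⊎_; inj₁; inj₂)
  open import Data.Vec using (lookup)
  open import Data.Vec.Properties using (lookup⇒[]=)
  open import Function using (_∘_)
  open import Relation.Binary.PropositionalEquality
  open import Relation.Nullary using (Dec; yes; no)
  open import Relation.Nullary.Decidable using (toWitness; map′; _×-dec_; _⊎-dec_; _→-dec_)

  -- With this, the pointwise facts below are decidable and are verified by evaluating their truth
  -- tables; there w stands for the test on the size.
  ∀-Bool? : {P : Bool → Set} → (∀ b → Dec (P b)) → Dec (∀ b → P b)
  ∀-Bool? P? = map′ (λ { (t , f) true → t ; (t , f) false → f }) (λ h → h true , h false) (P? true ×-dec P? false)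

  cover-two : ∀ w x y z → ind (exactlyTwo x y z ∧ w) ≡
    ind (not z ∧ (y ∧ (x ∧ w))) + ind (not y ∧ (z ∧ (x ∧ w))) + ind (not x ∧ (z ∧ (y ∧ w)))
  cover-two = toWitness {a? = ∀-Bool? λ w → ∀-Bool? λ x → ∀-Bool? λ y → ∀-Bool? λ z → _ ≟ _} _

  degree₁ : ∀ w x y z → ind ((exactlyTwo x y z ∧ w) ∧ x) ≡
    ind (not z ∧ (y ∧ (x ∧ w))) + ind (not y ∧ (z ∧ (x ∧ w)))
  degree₁ = toWitness {a? = ∀-Bool? λ w → ∀-Bool? λ x → ∀-Bool? λ y → ∀-Bool? λ z → _ ≟ _} _

  degree₂ : ∀ w x y z → ind ((exactlyTwo x y z ∧ w) ∧ y) ≡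
    ind (not z ∧ (y ∧ (x ∧ w))) + ind (not x ∧ (z ∧ (y ∧ w)))
  degree₂ = toWitness {a? = ∀-Bool? λ w → ∀-Bool? λ x → ∀-Bool? λ y → ∀-Bool? λ z → _ ≟ _} _

  degree₃ : ∀ w x y z → ind ((exactlyTwo x y z ∧ w) ∧ z) ≡
    ind (not y ∧ (z ∧ (x ∧ w))) + ind (not x ∧ (z ∧ (y ∧ w)))
  degree₃ = toWitness {a? = ∀-Bool? λ w → ∀-Bool? λ x → ∀-Bool? λ y → ∀-Bool? λ z → _ ≟ _} _

  degree-outside : ∀ w x y z v → ind ((exactlyTwo x y z ∧ w) ∧ v) ≤
    ind (v ∧ (y ∧ (x ∧ w))) + ind (v ∧ (z ∧ (x ∧ w))) + ind (v ∧ (z ∧ (y ∧ w)))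
  degree-outside = toWitness {a? = ∀-Bool? λ w → ∀-Bool? λ x → ∀-Bool? λ y → ∀-Bool? λ z → ∀-Bool? λ v → _ ≤? _} _

  two-or-three : ∀ f x y z → (f ≡ true → atLeastTwo x y z ≡ true) →
    ind f ≡ ind (f ∧ exactlyTwo x y z) + ind (f ∧ allThree x y z)
  two-or-three = toWitness {a? = ∀-Bool? λ f → ∀-Bool? λ x → ∀-Bool? λ y → ∀-Bool? λ z →
    ((f Bool.≟ true) →-dec (_ Bool.≟ true)) →-dec (_ ≟ _)} _

  incidences : ∀ f x y z → (f ≡ true → atLeastTwo x y z ≡ true) →
    (ind (f ∧ exactlyTwo x y z) + ind (f ∧ exactlyTwo x y z))
      + (ind (f ∧ allThree x y z) + ind (f ∧ allThree x y z) + ind (f ∧ allThree x y z))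
    ≡ ind (f ∧ x) + ind (f ∧ y) + ind (f ∧ z)
  incidences = toWitness {a? = ∀-Bool? λ f → ∀-Bool? λ x → ∀-Bool? λ y → ∀-Bool? λ z →
    ((f Bool.≟ true) →-dec (_ Bool.≟ true)) →-dec (_ ≟ _)} _

  two-twos-meet : ∀ x y z x′ y′ z′ → exactlyTwo x y z ≡ true → exactlyTwo x′ y′ z′ ≡ true →
    (x ≡ true × x′ ≡ true) ⊎ (y ≡ true × y′ ≡ true) ⊎ (z ≡ true × z′ ≡ true)
  two-twos-meet = toWitness {a? = ∀-Bool? λ x → ∀-Bool? λ y → ∀-Bool? λ z → ∀-Bool? λ x′ → ∀-Bool? λ y′ → ∀-Bool? λ z′ →
    (_ Bool.≟ _) →-dec ((_ Bool.≟ _) →-dec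
    (((x Bool.≟ true) ×-dec (x′ Bool.≟ true)) ⊎-dec ((y Bool.≟ true) ×-dec (y′ Bool.≟ true))
      ⊎-dec ((z Bool.≟ true) ×-dec (z′ Bool.≟ true))))} _

  total-+₃ : ∀ {n} (f g h : Subset n → ℕ) → total (λ E → f E + g E + h E) ≡ total f + total g + total h
  total-+₃ f g h = trans (total-+ (λ E → f E + g E) h) (cong (_+ total h) (total-+ f g))

  module _ {n : ℕ} (a b c : Fin n) where

    two three : Subset n → Bool
    two E   = exactlyTwo (lookup E a) (lookup E b) (lookup E c)
    three E = allThree (lookup E a) (lookup E b) (lookup E c)

    triangleFamily : ℕ → Family n
    triangleFamily r E = two E ∧ (∣ E ∣ ≡ᵇ r)

    triangleFamily-uniform : ∀ r → Uniform r (triangleFamily r)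
    triangleFamily-uniform r E KE = ≡ᵇ⁻ (proj₂ (∧⁻ (two E) KE))

    triangleFamily-intersecting : ∀ r → Intersecting (triangleFamily r)
    triangleFamily-intersecting r E E′ KE KE′
      with two-twos-meet (lookup E a) (lookup E b) (lookup E c) (lookup E′ a) (lookup E′ b) (lookup E′ c)
             (proj₁ (∧⁻ (two E) KE)) (proj₁ (∧⁻ (two E′) KE′))
    ... | inj₁ (p , p′)        = a , x∈p∩q⁺ (lookup⇒[]= a E p , lookup⇒[]= a E′ p′)
    ... | inj₂ (inj₁ (p , p′)) = b , x∈p∩q⁺ (lookup⇒[]= b E p , lookup⇒[]= b E′ p′)
    ... | inj₂ (inj₂ (p , p′)) = c , x∈p∩q⁺ (lookup⇒[]= c E p , lookup⇒[]= c E′ p′)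

    module _ {r N N₃ : ℕ} (a≢b : a ≢ b) (a≢c : a ≢ c) (b≢c : b ≢ c)
      (count-pair : ∀ {x y z : Fin n} → x ≢ y → x ≢ z → y ≢ z → count (class x y z true true false r) ≡ N)
      (count-triple : ∀ {x y z : Fin n} → x ≢ y → x ≢ z → y ≢ z → count (class x y z true true true r) ≤ N₃)
      (3N₃≤2N : 3 * N₃ ≤ 2 * N) where

      private
        K : Family n
        K = triangleFamily r

        ab ac bc : Subset n → ℕ
        ab = ind ∘ class a b c true true false r
        ac = ind ∘ class a c b true true false r
        bc = ind ∘ class b c a true true false r

        ab≡N : total ab ≡ N
        ab≡N = count-pair a≢b a≢c b≢c
        ac≡N : total ac ≡ N
        ac≡N = count-pair a≢c a≢b (b≢c ∘ sym)
        bc≡N : total bc ≡ N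
        bc≡N = count-pair b≢c (a≢b ∘ sym) (a≢c ∘ sym)

        N+N : N + N ≡ 2 * N
        N+N = cong (N +_) (sym (+-identityʳ N))

        k+k+k : ∀ k → k + k + k ≡ 3 * k
        k+k+k = solve-∀

      card-triangleFamily : card K ≡ 3 * N
      card-triangleFamily = begin
        card K                                        ≡⟨ card≡count K ⟩
        count K                                       ≡⟨ total-cong (λ E → cover-two (∣ E ∣ ≡ᵇ r) (lookup E a) (lookup E b) (lookup E c)) ⟩
        total (λ E → ab E + ac E + bc E)              ≡⟨ total-+₃ ab ac bc ⟩
        total ab + total ac + total bc                ≡⟨ cong₂ _+_ (cong₂ _+_ ab≡N ac≡N) bc≡N ⟩
        N + N + N                                     ≡⟨ k+k+k N ⟩
        3 * N                                         ∎
        where open ≡-Reasoning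

      private
        deg-vertex : ∀ v (f g : Subset n → ℕ) → (∀ E → ind (K E ∧ lookup E v) ≡ f E + g E) →
          total f ≡ N → total g ≡ N → deg K v ≡ 2 * N
        deg-vertex v f g pointwise f≡N g≡N = begin
          deg K v                              ≡⟨ deg≡count K v ⟩
          count (λ E → K E ∧ lookup E v)       ≡⟨ total-cong pointwise ⟩
          total (λ E → f E + g E)              ≡⟨ total-+ f g ⟩
          total f + total g                    ≡⟨ cong₂ _+_ f≡N g≡N ⟩
          N + N                                ≡⟨ N+N ⟩
          2 * N                                ∎
          where open ≡-Reasoning

        deg-a : deg K a ≡ 2 * N
        deg-a = deg-vertex a ab ac (λ E → degree₁ (∣ E ∣ ≡ᵇ r) (lookup E a) (lookup E b) (lookup E c)) ab≡N ac≡N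
        deg-b : deg K b ≡ 2 * N
        deg-b = deg-vertex b ab bc (λ E → degree₂ (∣ E ∣ ≡ᵇ r) (lookup E a) (lookup E b) (lookup E c)) ab≡N bc≡N
        deg-c : deg K c ≡ 2 * N
        deg-c = deg-vertex c ac bc (λ E → degree₃ (∣ E ∣ ≡ᵇ r) (lookup E a) (lookup E b) (lookup E c)) ac≡N bc≡N

        deg-other : ∀ v → a ≢ v → b ≢ v → c ≢ v → deg K v ≤ 2 * N
        deg-other v a≢v b≢v c≢v = begin
          deg K v                          ≡⟨ deg≡count K v ⟩
          count (λ E → K E ∧ lookup E v)   ≤⟨ total-mono (λ E → degree-outside (∣ E ∣ ≡ᵇ r) (lookup E a) (lookup E b) (lookup E c) (lookup E v)) ⟩
          total (λ E → via a b E + via a c E + via b c E) ≡⟨ total-+₃ (via a b) (via a c) (via b c) ⟩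
          total (via a b) + total (via a c) + total (via b c)
            ≤⟨ +-mono-≤ (+-mono-≤ (count-triple a≢b a≢v b≢v) (count-triple a≢c a≢v c≢v)) (count-triple b≢c b≢v c≢v) ⟩
          N₃ + N₃ + N₃                     ≡⟨ k+k+k N₃ ⟩
          3 * N₃                           ≤⟨ 3N₃≤2N ⟩
          2 * N                            ∎
          where
          open ≤-Reasoning
          via : Fin n → Fin n → Subset n → ℕ
          via x y = ind ∘ class x y v true true true r

      -- Each vertex belongs to two of the three classes of size N. A point outside lies in at most
      -- 3 N₃ members, one N₃ for each side, and 3 N₃ ≤ 2 N keeps the maximum at the vertices.
      Δ-triangleFamily : Δ K ≡ 2 * N
      Δ-triangleFamily = ≤-antisym (Δ≤ K deg≤) (≤-trans (≤-reflexive (sym deg-a)) (deg≤Δ K a))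
        where
        deg≤ : ∀ v → deg K v ≤ 2 * N
        deg≤ v with a Fin.≟ v | b Fin.≟ v | c Fin.≟ v
        ... | yes refl | _        | _        = ≤-reflexive deg-a
        ... | no _     | yes refl | _        = ≤-reflexive deg-b
        ... | no _     | no _     | yes refl = ≤-reflexive deg-c
        ... | no a≢v   | no b≢v   | no c≢v   = deg-other v a≢v b≢v c≢v

      module _ (F : Family n) (uniform : Uniform r F)
        (covers : ∀ E → F E ≡ true → atLeastTwo (lookup E a) (lookup E b) (lookup E c) ≡ true) where

        twos threes : Subset n → Bool
        twos E   = F E ∧ two E
        threes E = F E ∧ three E

        card-split : card F ≡ count twos + count threes
        card-split = trans (card≡count F) (trans
          (total-cong (λ E → two-or-three (F E) (lookup E a) (lookup E b) (lookup E c) (covers E)))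
          (total-+ (ind ∘ twos) (ind ∘ threes)))

        -- Double counting of incidences between members and the three vertices, each of degree at
        -- most Δ F.
        degree-sum : 2 * count twos + 3 * count threes ≤ 3 * Δ F
        degree-sum = begin
          2 * α + 3 * τ                         ≡⟨ expand α τ ⟩
          (α + α) + (τ + τ + τ)                 ≡⟨ cong₂ _+_ (total-+ t₂ t₂) (total-+₃ t₃ t₃ t₃) ⟨
          total (λ E → t₂ E + t₂ E) + total (λ E → t₃ E + t₃ E + t₃ E)
            ≡⟨ total-+ (λ E → t₂ E + t₂ E) (λ E → t₃ E + t₃ E + t₃ E) ⟨
          total (λ E → (t₂ E + t₂ E) + (t₃ E + t₃ E + t₃ E))
            ≡⟨ total-cong (λ E → incidences (F E) (lookup E a) (lookup E b) (lookup E c) (covers E)) ⟩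
          total (λ E → at a E + at b E + at c E)    ≡⟨ total-+₃ (at a) (at b) (at c) ⟩
          total (at a) + total (at b) + total (at c)
            ≡⟨ cong₂ _+_ (cong₂ _+_ (deg≡count F a) (deg≡count F b)) (deg≡count F c) ⟨
          deg F a + deg F b + deg F c           ≤⟨ +-mono-≤ (+-mono-≤ (deg≤Δ F a) (deg≤Δ F b)) (deg≤Δ F c) ⟩
          Δ F + Δ F + Δ F                       ≡⟨ k+k+k (Δ F) ⟩
          3 * Δ F                               ∎
          where
          open ≤-Reasoning
          α τ : ℕ
          α = count twos
          τ = count threes
          t₂ t₃ : Subset n → ℕ
          t₂ = ind ∘ twos
          t₃ = ind ∘ threes
          at : Fin n → Subset n → ℕ
          at v E = ind (F E ∧ lookup E v)
          expand : ∀ α τ → 2 * α + 3 * τ ≡ (α + α) + (τ + τ + τ)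
          expand = solve-∀

        private
          twos⊆K : ∀ E → twos E ≡ true → K E ≡ true
          twos⊆K E eq = let FE , two = ∧⁻ (F E) eq in ∧⁺ two (≡ᵇ⁺ (uniform E FE))

          countK : count K ≡ 3 * N
          countK = trans (sym (card≡count K)) card-triangleFamily

        twos≤ : count twos ≤ 3 * N
        twos≤ = ≤-trans (count-mono twos⊆K) (≤-reflexive countK)

        -- The members with exactly two vertices form a subfamily of K, which has 3N sets, so a
        -- count of 3N leaves none of K out.
        triangleFamily⊆ : 3 * N ≤ count twos → ∀ E → K E ≡ true → F E ≡ true
        triangleFamily⊆ 3N≤ E KE = proj₁ (∧⁻ (F E) (ind-mono⁻¹
          (total-squeeze (λ E → ind-mono (twos⊆K E)) (≤-trans (≤-reflexive countK) 3N≤) E) KE))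

        exactly-two : count threes ≡ 0 → ∀ E → F E ≡ true → two E ≡ true
        exactly-two none E FE = proj₂ (∧⁻ (F E) (ind-mono⁻¹ (≤-trans (≤-reflexive split) (≤-trans
            (+-monoʳ-≤ (ind (twos E)) no-three) (≤-reflexive (+-identityʳ _)))) FE))
          where
          no-three : ind (threes E) ≤ 0
          no-three = total-squeeze {f = λ _ → 0} (λ _ → z≤n) (≤-trans (≤-reflexive none) z≤n) E
          split : ind (F E) ≡ ind (twos E) + ind (threes E)
          split = two-or-three (F E) (lookup E a) (lookup E b) (lookup E c) (covers E)

-- Structure of a family of maximum weighted diversity

module Extremal where

  open Counting
  open HeavyPairs
  open Cuts
  open Arithmetic
  open Triangles
  open import Data.Bool using (true; false)
  open import Data.Empty using (⊥-elim)
  open import Data.Fin using (Fin)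
  open import Data.Nat
  open import Data.Nat.Properties
  open import Data.Product using (∃; _×_; _,_; proj₁; proj₂)
  import Data.Rational as ℚ
  open import Data.Sum using ([_,_]′)
  open import Data.Vec using (lookup)
  open import Relation.Binary.PropositionalEquality
  open import Relation.Nullary using (¬_)

  TriangleStructure : ∀ {n} → ℝ → (r N : ℕ) → Family n → Set
  TriangleStructure C r N F = ∃ λ a → ∃ λ b → ∃ λ c → a ≢ b × a ≢ c × b ≢ c
    × (∀ E → triangleFamily a b c r E ≡ true → F E ≡ true)
    × (∀ E → F E ≡ true → atLeastTwo (lookup E a) (lookup E b) (lookup E c) ≡ true)
    × (1<C C → ∀ E → F E ≡ true → two a b c E ≡ true)
    × (⟦ card F ⟧ ℚ.- ⟦ 3 * N ⟧) ≤ C · (⟦ Δ F ⟧ ℚ.- ⟦ 2 * N ⟧)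

  module _ {n r N N₃ u d : ℕ} (C : ℝ) (1≤C : 1≤C C) (C<3/2 : C<3/2 C) (2≤r : 2 ≤ r)
    (d<u : suc d ≤ u) (u< : u * 2 < 3 * suc d)
    (slope : ∀ g f x y → y ≤ x → (⟦ g ⟧ ℚ.- ⟦ f ⟧) ≤ C · (⟦ x ⟧ ℚ.- ⟦ y ⟧) → Cleared C u d g f x y)
    (count-pair : ∀ {x y z : Fin n} → x ≢ y → x ≢ z → y ≢ z → count (class x y z true true false r) ≡ N)
    (count-triple : ∀ {x y z : Fin n} → x ≢ y → x ≢ z → y ≢ z → count (class x y z true true true r) ≤ N₃)
    (3N₃≤2N : 3 * N₃ ≤ 2 * N) (growth : suc d * (r * (r * (r * N₃))) < N)
    {x₀ y₀ z₀ : Fin n} (x₀≢y₀ : x₀ ≢ y₀) (x₀≢z₀ : x₀ ≢ z₀) (y₀≢z₀ : y₀ ≢ z₀)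
    (F : Family n) (maximal : MaxDiv r C F) where

    private
      uniform : Uniform r F
      uniform = proj₁ maximal

      -- Maximality enters only here. The size and maximum degree of a triangle family do not depend
      -- on its vertices, so a fixed triple can be compared with F before the triangle of F is
      -- known.
      competitor : (⟦ 3 * N ⟧ ℚ.- ⟦ card F ⟧) ≤ C · (⟦ 2 * N ⟧ ℚ.- ⟦ Δ F ⟧)
      competitor = subst₂ (λ k l → (⟦ k ⟧ ℚ.- ⟦ card F ⟧) ≤ C · (⟦ l ⟧ ℚ.- ⟦ Δ F ⟧))
        (card-triangleFamily x₀ y₀ z₀ x₀≢y₀ x₀≢z₀ y₀≢z₀ count-pair count-triple 3N₃≤2N)
        (Δ-triangleFamily x₀ y₀ z₀ x₀≢y₀ x₀≢z₀ y₀≢z₀ count-pair count-triple 3N₃≤2N)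
        (proj₂ (proj₂ maximal) (triangleFamily x₀ y₀ z₀ r)
          (triangleFamily-uniform x₀ y₀ z₀ r) (triangleFamily-intersecting x₀ y₀ z₀ r))

      -- The sign of 2N - Δ(F) decides on which side of C the slope may be taken; this and `above`
      -- are the two readings of `competitor`.
      below : Δ F ≤ 2 * N → Cleared C u d (3 * N) (card F) (2 * N) (Δ F)
      below Δ≤2N = slope (3 * N) (card F) (2 * N) (Δ F) Δ≤2N competitor

      above : 2 * N ≤ Δ F → 3 * N + Δ F ≤ 2 * N + card F
      above 2N≤Δ = unit-slope C 1≤C (3 * N) (card F) (2 * N) (Δ F) 2N≤Δ competitor

    not-star : ¬ (card F ≤ Δ F + r * (r * (r * N₃)))
    not-star f≤ = <⇒≱ growth N≤
      where
      L : ℕ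
      L = r * (r * (r * N₃))
      N≤ : N ≤ suc d * L
      N≤ = [ (λ Δ≤2N → star-small {u} {d} {N} {card F} {Δ F} {L} d<u u< Δ≤2N f≤ (below Δ≤2N))
           , (λ 2N≤Δ → ≤-trans (star-small′ {N} {card F} {Δ F} {L} f≤ (above 2N≤Δ)) (m≤n*m L (suc d)))
           ]′ (≤-total (Δ F) (2 * N))

    module _ {a b c : Fin n} (a≢b : a ≢ b) (a≢c : a ≢ c) (b≢c : b ≢ c)
      (covers : ∀ E → F E ≡ true → atLeastTwo (lookup E a) (lookup E b) (lookup E c) ≡ true) where

      private
        α τ : ℕ
        α = count (twos a b c a≢b a≢c b≢c count-pair count-triple 3N₃≤2N F uniform covers)
        τ = count (threes a b c a≢b a≢c b≢c count-pair count-triple 3N₃≤2N F uniform covers)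

        f≡α+τ : card F ≡ α + τ
        f≡α+τ = card-split a b c a≢b a≢c b≢c count-pair count-triple 3N₃≤2N F uniform covers

        degrees : 2 * α + 3 * τ ≤ 3 * Δ F
        degrees = degree-sum a b c a≢b a≢c b≢c count-pair count-triple 3N₃≤2N F uniform covers

        α≤3N : α ≤ 3 * N
        α≤3N = twos≤ a b c a≢b a≢c b≢c count-pair count-triple 3N₃≤2N F uniform covers

        below-ατ : Δ F ≤ 2 * N → 3 * N ≤ α × τ ≡ 0
        below-ατ Δ≤2N = extremal-below {α} {τ} {Δ F} degrees {u} {d} {N} u< Δ≤2N
          (subst (λ k → Cleared C u d (3 * N) k (2 * N) (Δ F)) f≡α+τ (below Δ≤2N))

        3N≤α : 3 * N ≤ α
        3N≤α = [ (λ Δ≤2N → proj₁ (below-ατ Δ≤2N))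
               , (λ 2N≤Δ → extremal-above {α} {τ} {Δ F} degrees {N} (subst (λ k → 3 * N + Δ F ≤ 2 * N + k) f≡α+τ (above 2N≤Δ)))
               ]′ (≤-total (Δ F) (2 * N))

        τ≡0-above : 2 * N ≤ Δ F → 1<C C → τ ≡ 0
        τ≡0-above 2N≤Δ 1<C = let u′ , d′ , d′<u′ , slope′ = lower-slope C 1<C in
          no-triples {α} {τ} {Δ F} degrees {u′} {d′} {N} d′<u′ (≤-antisym α≤3N 3N≤α)
            (subst (λ k → Cleared C u′ d′ (3 * N) k (2 * N) (Δ F)) f≡α+τ
              (slope′ (3 * N) (card F) (2 * N) (Δ F) 2N≤Δ competitor))

        τ≡0 : 1<C C → τ ≡ 0
        τ≡0 1<C = [ (λ Δ≤2N → proj₂ (below-ατ Δ≤2N)) , (λ 2N≤Δ → τ≡0-above 2N≤Δ 1<C) ]′ (≤-total (Δ F) (2 * N))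

      contains-triangleFamily : ∀ E → triangleFamily a b c r E ≡ true → F E ≡ true
      contains-triangleFamily =
        triangleFamily⊆ a b c a≢b a≢c b≢c count-pair count-triple 3N₃≤2N F uniform covers 3N≤α

      within-two : 1<C C → ∀ E → F E ≡ true → two a b c E ≡ true
      within-two 1<C = exactly-two a b c a≢b a≢c b≢c count-pair count-triple 3N₃≤2N F uniform covers (τ≡0 1<C)

      diversity-bound : (⟦ card F ⟧ ℚ.- ⟦ 3 * N ⟧) ≤ C · (⟦ Δ F ⟧ ℚ.- ⟦ 2 * N ⟧)
      diversity-bound = subst (λ k → (⟦ k ⟧ ℚ.- ⟦ 3 * N ⟧) ≤ C · (⟦ Δ F ⟧ ℚ.- ⟦ 2 * N ⟧)) (sym f≡α+τ)
        (from-slopes C 1≤C C<3/2 (α + τ) (3 * N) (Δ F) (2 * N)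
          (slope-one {α} {τ} {Δ F} degrees {N} α≤3N) (slope-three-halves {α} {τ} {Δ F} degrees N))

    maximal-structure : TriangleStructure C r N F
    maximal-structure = [ (λ star → ⊥-elim (not-star star))
      , (λ (a , b , c , a≢b , a≢c , b≢c , covers) → a , b , c , a≢b , a≢c , b≢c ,
          contains-triangleFamily a≢b a≢c b≢c covers , covers ,
          within-two a≢b a≢c b≢c covers , diversity-bound a≢b a≢c b≢c covers)
      ]′ (dichotomy 2≤r count-triple F uniform (proj₁ (proj₂ maximal)))

-- Permuting the ground set so that the triangle becomes the first three points

module Relabelling where

  open Counting
  open HeavyPairs
  open Triangles
  open import Data.Bool using (Bool; true; false; if_then_else_)
  import Data.Bool.Properties as Bool
  open import Data.Fin using (Fin; zero; suc; toℕ; punchIn; punchOut)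
  open import Data.Fin.Patterns using (0F; 1F; 2F)
  import Data.Fin as Fin
  import Data.Fin.Properties as Fin
  open import Data.Fin.Permutation using (Permutation; _⟨$⟩ʳ_; insert; insert-punchIn; id)
  open import Data.Fin.Subset using (Subset; ∣_∣)
  open import Data.List using ([]; length; filterᵇ; tabulate)
  open import Data.Nat
  open import Data.Nat.Properties
  open import Algebra.Properties.CommutativeMonoid.Sum +-0-commutativeMonoid using (sum; sum-permute)
  open import Data.Product using (∃; _×_; _,_; proj₁; proj₂)
  open import Data.Vec using ([]; _∷_; lookup)
  import Data.Vec as Vec
  open import Data.Vec.Properties using (lookup∘tabulate)
  open import Function using (_∘_)
  open import Relation.Binary.PropositionalEquality
  open import Relation.Nullary using (yes; no; contradiction)
  open import Relation.Nullary.Decidable using (toWitness; _→-dec_)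

  insert-here : ∀ {m n} i j (π : Permutation m n) → insert i j π ⟨$⟩ʳ i ≡ j
  insert-here i j π with i Fin.≟ i
  ... | yes _  = refl
  ... | no i≢i = contradiction refl i≢i

  insert-there : ∀ {m n i k} j (π : Permutation m n) (i≢k : i ≢ k) →
    insert i j π ⟨$⟩ʳ k ≡ punchIn j (π ⟨$⟩ʳ punchOut i≢k)
  insert-there {i = i} {k} j π i≢k = trans
    (cong (insert i j π ⟨$⟩ʳ_) (sym (Fin.punchIn-punchOut i≢k)))
    (insert-punchIn i j π (punchOut i≢k))

  -- Three nested insertions: each sends a vertex to the first position still available, and
  -- `punchOut` renames the later vertices once the earlier ones are removed.
  move-to-front : ∀ {m} {a b c : Fin (3 + m)} → a ≢ b → a ≢ c → b ≢ c →
    ∃ λ (σ : Permutation (3 + m) (3 + m)) → σ ⟨$⟩ʳ a ≡ 0F × σ ⟨$⟩ʳ b ≡ 1F × σ ⟨$⟩ʳ c ≡ 2F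
  move-to-front {m} {a} {b} {c} a≢b a≢c b≢c = σ , insert-here a 0F σ₁
    , trans (insert-there 0F σ₁ a≢b) (cong suc (insert-here b′ 0F σ₂))
    , trans (insert-there 0F σ₁ a≢c) (cong suc (trans (insert-there 0F σ₂ b′≢c′)
        (cong suc (insert-here (punchOut b′≢c′) 0F id))))
    where
    b′ c′ : Fin (2 + m)
    b′ = punchOut a≢b
    c′ = punchOut a≢c
    b′≢c′ : b′ ≢ c′
    b′≢c′ eq = b≢c (Fin.punchOut-injective a≢b a≢c eq)
    σ₂ : Permutation (1 + m) (1 + m)
    σ₂ = insert (punchOut b′≢c′) 0F id
    σ₁ : Permutation (2 + m) (2 + m)
    σ₁ = insert b′ 0F σ₂
    σ : Permutation (3 + m) (3 + m)
    σ = insert a 0F σ₁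

  size-tabulate : ∀ {n} (f : Fin n → Bool) → ∣ Vec.tabulate f ∣ ≡ sum (ind ∘ f)
  size-tabulate {zero}  f = refl
  size-tabulate {suc n} f with f zero
  ... | true  = cong suc (size-tabulate (f ∘ suc))
  ... | false = size-tabulate (f ∘ suc)

  size≡sum : ∀ {n} (E : Subset n) → ∣ E ∣ ≡ sum (ind ∘ lookup E)
  size≡sum []          = refl
  size≡sum (true ∷ E)  = cong suc (size≡sum E)
  size≡sum (false ∷ E) = size≡sum E

  size-⟪⟫ : ∀ {n} (E : Subset n) (σ : Permutation n n) → ∣ E ⟪ σ ⟫ ∣ ≡ ∣ E ∣
  size-⟪⟫ E σ = begin
    ∣ E ⟪ σ ⟫ ∣                         ≡⟨ size-tabulate (λ i → lookup E (σ ⟨$⟩ʳ i)) ⟩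
    sum (λ i → ind (lookup E (σ ⟨$⟩ʳ i))) ≡⟨ sum-permute (ind ∘ lookup E) σ ⟨
    sum (ind ∘ lookup E)                ≡⟨ size≡sum E ⟨
    ∣ E ∣                               ∎
    where open ≡-Reasoning

  private
    filter-none : ∀ {A : Set} {n} (g : A → Bool) (f : Fin n → A) → (∀ i → g (f i) ≡ false) →
      filterᵇ g (tabulate f) ≡ []
    filter-none {n = zero}  g f none = refl
    filter-none {n = suc n} g f none with g (f zero) | none zero
    ... | false | refl = filter-none g (f ∘ suc) (none ∘ suc)

  inK-first-three : ∀ {m} (E : Subset (3 + m)) → inK E ≡ ind (lookup E 0F) + ind (lookup E 1F) + ind (lookup E 2F)
  inK-first-three {m} (x ∷ y ∷ z ∷ E)
    -- Indices from 3 on fail the test whatever their bit, so only the first three entries can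
    -- survive the filter.
    with tail-empty ← filter-none (λ i → if toℕ i <ᵇ 3 then lookup (x ∷ y ∷ z ∷ E) i else false)
           (λ (i : Fin m) → suc (suc (suc i))) (λ i → refl)
    with x | y | z
  ... | true  | true  | true  = cong (λ l → 3 + length l) tail-empty
  ... | true  | true  | false = cong (λ l → 2 + length l) tail-empty
  ... | true  | false | true  = cong (λ l → 2 + length l) tail-empty
  ... | true  | false | false = cong (λ l → 1 + length l) tail-empty
  ... | false | true  | true  = cong (λ l → 2 + length l) tail-empty
  ... | false | true  | false = cong (λ l → 1 + length l) tail-empty
  ... | false | false | true  = cong (λ l → 1 + length l) tail-empty
  ... | false | false | false = cong length tail-empty

  exactlyTwo⁺ : ∀ x y z → ind x + ind y + ind z ≡ 2 → exactlyTwo x y z ≡ true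
  exactlyTwo⁺ = toWitness {a? = ∀-Bool? λ x → ∀-Bool? λ y → ∀-Bool? λ z → (_ ≟ 2) →-dec (_ Bool.≟ true)} _

  exactlyTwo⁻ : ∀ x y z → exactlyTwo x y z ≡ true → ind x + ind y + ind z ≡ 2
  exactlyTwo⁻ = toWitness {a? = ∀-Bool? λ x → ∀-Bool? λ y → ∀-Bool? λ z → (_ Bool.≟ true) →-dec (_ ≟ 2)} _

  atLeastTwo⁻ : ∀ x y z → atLeastTwo x y z ≡ true → 2 ≤ ind x + ind y + ind z
  atLeastTwo⁻ = toWitness {a? = ∀-Bool? λ x → ∀-Bool? λ y → ∀-Bool? λ z → (_ Bool.≟ true) →-dec (2 ≤? _)} _

  private
    cong₃ : ∀ {A B : Set} (f : A → A → A → B) {x x′ y y′ z z′} → x ≡ x′ → y ≡ y′ → z ≡ z′ → f x y z ≡ f x′ y′ z′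
    cong₃ f refl refl refl = refl

  module _ {m : ℕ} {a b c : Fin (3 + m)} (a≢b : a ≢ b) (a≢c : a ≢ c) (b≢c : b ≢ c) where

    -- `E ⟪ σ ⟫` has at v the bit of E at σ v. So σ has to carry a, b, c to the first three points,
    -- not the other way round, for `F (E ⟪ σ ⟫)` to speak of the first three bits of E.
    relabel : Permutation (3 + m) (3 + m)
    relabel = proj₁ (move-to-front a≢b a≢c b≢c)

    private
      lookup-⟪⟫ : ∀ {v k} → relabel ⟨$⟩ʳ v ≡ k → ∀ E → lookup (E ⟪ relabel ⟫) v ≡ lookup E k
      lookup-⟪⟫ {v} eq E = trans (lookup∘tabulate (λ i → lookup E (relabel ⟨$⟩ʳ i)) v) (cong (lookup E) eq)

      at-a : ∀ E → lookup (E ⟪ relabel ⟫) a ≡ lookup E 0F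
      at-a = lookup-⟪⟫ (proj₁ (proj₂ (move-to-front a≢b a≢c b≢c)))
      at-b : ∀ E → lookup (E ⟪ relabel ⟫) b ≡ lookup E 1F
      at-b = lookup-⟪⟫ (proj₁ (proj₂ (proj₂ (move-to-front a≢b a≢c b≢c))))
      at-c : ∀ E → lookup (E ⟪ relabel ⟫) c ≡ lookup E 2F
      at-c = lookup-⟪⟫ (proj₂ (proj₂ (proj₂ (move-to-front a≢b a≢c b≢c))))

      at-abc : ∀ {A : Set} (f : Bool → Bool → Bool → A) E →
        f (lookup (E ⟪ relabel ⟫) a) (lookup (E ⟪ relabel ⟫) b) (lookup (E ⟪ relabel ⟫) c)
        ≡ f (lookup E 0F) (lookup E 1F) (lookup E 2F)
      at-abc f E = cong₃ f (at-a E) (at-b E) (at-c E)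

    module _ {r : ℕ} {F : Family (3 + m)} (uniform : Uniform r F) where

      private
        size : ∀ E → F (E ⟪ relabel ⟫) ≡ true → ∣ E ∣ ≡ r
        size E FE = trans (sym (size-⟪⟫ E relabel)) (uniform (E ⟪ relabel ⟫) FE)

      A𝕂⊆ : (∀ E → triangleFamily a b c r E ≡ true → F E ≡ true) → ∀ E → A𝕂 r E → F (E ⟪ relabel ⟫) ≡ true
      A𝕂⊆ K⊆F E (size≡r , inK≡2) = K⊆F (E ⟪ relabel ⟫) (∧⁺ two-abc (≡ᵇ⁺ (trans (size-⟪⟫ E relabel) size≡r)))
        where
        two-abc : two a b c (E ⟪ relabel ⟫) ≡ true
        two-abc = trans (at-abc exactlyTwo E)
          (exactlyTwo⁺ (lookup E 0F) (lookup E 1F) (lookup E 2F) (trans (sym (inK-first-three E)) inK≡2))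

      ⊆A𝕂⁺ : (∀ E → F E ≡ true → atLeastTwo (lookup E a) (lookup E b) (lookup E c) ≡ true) →
        ∀ E → F (E ⟪ relabel ⟫) ≡ true → A𝕂⁺ r E
      ⊆A𝕂⁺ covers E FE = size E FE , ≤-trans
        (atLeastTwo⁻ (lookup E 0F) (lookup E 1F) (lookup E 2F)
          (trans (sym (at-abc atLeastTwo E)) (covers (E ⟪ relabel ⟫) FE)))
        (≤-reflexive (sym (inK-first-three E)))

      ⊆A𝕂 : (∀ E → F E ≡ true → two a b c E ≡ true) → ∀ E → F (E ⟪ relabel ⟫) ≡ true → A𝕂 r E
      ⊆A𝕂 twos E FE = size E FE , trans (inK-first-three E)
        (exactlyTwo⁻ (lookup E 0F) (lookup E 1F) (lookup E 2F)
          (trans (sym (at-abc exactlyTwo E)) (twos (E ⟪ relabel ⟫) FE)))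

-- The threshold for n and the assembly of the theorem

module Conclusion where

  open Counting
  open Cuts
  open Arithmetic
  open Extremal
  open Relabelling
  open import Data.Bool using (true; false)
  open import Data.Fin using (Fin)
  open import Data.Fin.Patterns using (0F; 1F; 2F)
  open import Data.Fin.Permutation using (Permutation)
  open import Data.Fin.Subset using (Subset)
  open import Data.Nat
  open import Data.Nat.Combinatorics using () renaming (_C_ to _choose_)
  open import Data.Nat.Properties
  open import Data.Product using (∃; _×_; _,_; proj₁)
  import Data.Rational as ℚ
  open import Data.Nat.Tactic.RingSolver using (solve-∀)
  open import Relation.Binary.PropositionalEquality

  -- Above this threshold (3 + (1 + d) r³) N₃ ≤ N, where N₃ and N count the r-sets through three points, respectively
  -- through two points and avoiding a third.
  factor threshold : ℕ → ℕ → ℕ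
  factor s d = 3 + suc d * ((3 + s) * ((3 + s) * (3 + s)))
  threshold s d = 3 + (s + suc s * factor s d)

  module _ {m s d : ℕ} (m-large : s + suc s * factor s d ≤ m) where

    private
      N N₃ : ℕ
      N  = m choose suc s
      N₃ = m choose s

      factor*N₃≤N : factor s d * N₃ ≤ N
      factor*N₃≤N = choose-growth (factor s d) m-large

    3N₃≤2N : 3 * N₃ ≤ 2 * N
    3N₃≤2N = ≤-trans (*-monoˡ-≤ N₃ (m≤m+n 3 (suc d * ((3 + s) * ((3 + s) * (3 + s)))))) (≤-trans factor*N₃≤N (m≤n*m N 2))

    growth : suc d * ((3 + s) * ((3 + s) * ((3 + s) * N₃))) < N
    growth = begin-strict
      suc d * (r * (r * (r * N₃)))        ≡⟨ reassoc (suc d) r N₃ ⟩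
      -- The summand 3 of `factor` supplies the strictness here, in addition to giving 3 N₃ ≤ 2 N;
      -- strictness also needs N₃ > 0.
      suc d * (r * (r * r)) * N₃          <⟨ *-monoˡ-< N₃ {{>-nonZero N₃>0}} (m<n+m (suc d * (r * (r * r))) {3} (s≤s z≤n)) ⟩
      factor s d * N₃                     ≤⟨ factor*N₃≤N ⟩
      N                                   ∎
      where
      open ≤-Reasoning
      r : ℕ
      r = 3 + s
      N₃>0 : 0 < N₃
      N₃>0 = choose-positive (≤-trans (m≤m+n s _) m-large)
      reassoc : ∀ e r k → e * (r * (r * (r * k))) ≡ e * (r * (r * r)) * k
      reassoc = solve-∀

  -- Writing n = 3 + m and r = 3 + s lets the truncated differences `n ∸ 3` and `r ∸ 2` compute. One
  -- relabelling serves both cases of C.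
  conclusion : ∀ {m s u d} (C : ℝ) → 1≤C C → C<3/2 C → suc d ≤ u → u * 2 < 3 * suc d →
    (∀ g f x y → y ≤ x → (⟦ g ⟧ ℚ.- ⟦ f ⟧) ≤ C · (⟦ x ⟧ ℚ.- ⟦ y ⟧) → Cleared C u d g f x y) →
    s + suc s * factor s d ≤ m → (F : Family (3 + m)) → MaxDiv (3 + s) C F →
    (C≤1 C → ∃ λ (σ : Permutation (3 + m) (3 + m)) → ∀ (E : Subset (3 + m)) →
      (A𝕂 (3 + s) E → F (E ⟪ σ ⟫) ≡ true) × (F (E ⟪ σ ⟫) ≡ true → A𝕂⁺ (3 + s) E))
    × (1<C C → ∃ λ (σ : Permutation (3 + m) (3 + m)) → ∀ (E : Subset (3 + m)) →
      (A𝕂 (3 + s) E → F (E ⟪ σ ⟫) ≡ true) × (F (E ⟪ σ ⟫) ≡ true → A𝕂 (3 + s) E))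
    × ((⟦ card F ⟧ ℚ.- ⟦ 3 ⟧ ℚ.* ⟦ m choose suc s ⟧) ≤ C · (⟦ Δ F ⟧ ℚ.- ⟦ 2 ⟧ ℚ.* ⟦ m choose suc s ⟧))
  conclusion {m} {s} {u} {d} C 1≤C C<3/2 d<u u< slope m-large F maximal =
    let uniform = proj₁ maximal
        a , b , c , a≢b , a≢c , b≢c , K⊆F , covers , within , bound = structure
        σ = relabel a≢b a≢c b≢c
    in (λ _ → σ , λ E → A𝕂⊆ a≢b a≢c b≢c uniform K⊆F E , ⊆A𝕂⁺ a≢b a≢c b≢c uniform covers E)
     , (λ 1<C → σ , λ E → A𝕂⊆ a≢b a≢c b≢c uniform K⊆F E , ⊆A𝕂 a≢b a≢c b≢c uniform (within 1<C) E)
     , subst₂ (λ x y → (⟦ card F ⟧ ℚ.- x) ≤ C · (⟦ Δ F ⟧ ℚ.- y)) (sym (⟦⟧-* 3 N)) (sym (⟦⟧-* 2 N)) bound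
    where
    N N₃ : ℕ
    N  = m choose suc s
    N₃ = m choose s
    count-pair : ∀ {x y z : Fin (3 + m)} → x ≢ y → x ≢ z → y ≢ z → count (class x y z true true false (3 + s)) ≡ N
    count-pair x≢y x≢z y≢z = count-class x≢y x≢z y≢z true true false (suc s)
    count-triple : ∀ {x y z : Fin (3 + m)} → x ≢ y → x ≢ z → y ≢ z → count (class x y z true true true (3 + s)) ≤ N₃
    count-triple x≢y x≢z y≢z = ≤-reflexive (count-class x≢y x≢z y≢z true true true s)
    2≤r : 2 ≤ 3 + s
    2≤r = s≤s (s≤s z≤n)
    structure : TriangleStructure C (3 + s) N F
    structure = maximal-structure C 1≤C C<3/2 2≤r d<u u< slope count-pair count-triple
      (3N₃≤2N {d = d} m-large) (growth {d = d} m-large) {0F} {1F} {2F} (λ ()) (λ ()) (λ ()) F maximal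

open import Data.Nat using (ℕ; suc; _≤_; _∸_; z≤n; s≤s)
open import Data.Nat.Combinatorics using () renaming (_C_ to _choose_)
open import Data.Product using (∃; _×_; _,_)
open import Data.Bool using (true)
open import Data.Fin.Subset using (Subset)
open import Data.Fin.Permutation using (Permutation)
open import Data.Rational using (_-_; _*_)
open import Relation.Binary.PropositionalEquality using (_≡_)

theorem1 : (r : ℕ) → 3 ≤ r → (C : ℝ) → 1≤C C → C<3/2 C →
    ∃ λ (n₀ : ℕ) → ∀ (n : ℕ) → n₀ ≤ n → (F : Family n) → MaxDiv r C F →
    ((C≤1 C → ∃ λ (σ : Permutation n n) → ∀ (E : Subset n) →
    (A𝕂 r E → F (E ⟪ σ ⟫) ≡ true) × (F (E ⟪ σ ⟫) ≡ true → A𝕂⁺ r E))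
    × (1<C C → ∃ λ (σ : Permutation n n) → ∀ (E : Subset n) →
    (A𝕂 r E → F (E ⟪ σ ⟫) ≡ true) × (F (E ⟪ σ ⟫) ≡ true → A𝕂 r E))
    × ((⟦ card F ⟧ - ⟦ 3 ⟧ * ⟦ (n ∸ 3) choose (r ∸ 2) ⟧)
    ≤ C · (⟦ Δ F ⟧ - ⟦ 2 ⟧ * ⟦ (n ∸ 3) choose (r ∸ 2) ⟧)))
theorem1 (suc (suc (suc s))) (s≤s (s≤s (s≤s z≤n))) C 1≤C C<3/2 =
  let u , d , d<u , u< , slope = Cuts.upper-slope C 1≤C C<3/2 in
  -- The leading 3 of the threshold forces n = 3 + m, and what remains of the inequality is the
  -- growth condition on m.
  Conclusion.threshold s d ,
  λ { (suc (suc (suc m))) (s≤s (s≤s (s≤s m-large))) →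
      Conclusion.conclusion {m} {s} {u} {d} C 1≤C C<3/2 d<u u< slope m-large }
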